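{- Suppose that $\theta,\kappa$ are infinite regular cardinals with $\kappa>2^\theta$. If $\kappa$ carries a uniform ultrafilter that is $\mu$-indecomposable for every cardinal $\mu\in[\theta,\kappa)$, then there exists a cardinal $\mu<\theta$ such that $\chi(\vec C)\le\mu$ for every transversal $\vec C$ for $\square(\kappa,{<}\kappa)$.
   Context: For a set of ordinals $A$, $\mathrm{acc}(A)=\{\alpha\in A\mid\sup(A\cap\alpha)=\alpha>0\}$. A $\square(\kappa,{<}\kappa)$-sequence is a sequence $\langle\mathcal C_\alpha\mid\alpha<\kappa\rangle$ such that each $\mathcal C_\alpha$ is a nonempty family of fewer than $\kappa$ closed subsets $C$ of $\alpha$ with $\sup(C)=\sup(\alpha)$; for every $C\in\mathcal C_\alpha$ and $\bar\alpha\in\mathrm{acc}(C)$, $C\cap\bar\alpha\in\mathcal C_{\bar\alpha}$; and there is no club $D\subseteq\kappa$ with $D\cap\alpha\in\mathcal C_\alpha$ for all $\alpha\in\mathrm{acc}(D)$. A transversal for $\square(\kappa,{<}\kappa)$ is a sequence $\langle C_\alpha\mid\alpha<\kappa\rangle$ with $C_\alpha\in\mathcal C_\alpha$ for all $\alpha$, for some $\square(\kappa,{<}\kappa)$-sequence $\langle\mathcal C_\alpha\mid\alpha<\kappa\rangle$. For a sequence $\vec C=\langle C_\beta\mid\beta<\kappa\rangle$, $\chi(\vec C)$ is the least cardinal $\chi\le\kappa$ such that there exist $\Delta\in[\kappa]^\kappa$ and $b:\kappa\to[\kappa]^\chi$ with $\Delta\cap\alpha\subseteq\bigcup_{\beta\in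 b(\alpha)}C_\beta$ for every $\alpha<\kappa$. An ultrafilter $U$ over $\kappa$ is uniform if all its members have size $\kappa$; it is $\mu$-indecomposable if for every $f:\kappa\to\mu$ there is $H\subseteq\mu$ with $|H|<\mu$ and $f^{ -1}[H]\in U$. -}

module Defs where

open import Level using (Level; _⊔_; suc)
open import Data.Bool.Base using (Bool)
open import Data.Fin.Base using (Fin)
open import Data.Nat.Base using (ℕ)
open import Data.Product.Base using (Σ; Σ-syntax; ∃-syntax; _×_; proj₁)
open import Data.Sum.Base using (_⊎_)
open import Function.Bundles using (Injection; Bijection)
import Function.Relation.Binary.Setoid.Equality as FunctionSetoid
open import Induction.WellFounded using (WellFounded)
open import Relation.Binary.Bundles using (Setoid)
import Relation.Binary.Construct.On as On
import Relation.Binary.Construct.StrictToNonStrict as StrictToNonStrict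
open import Relation.Binary.Core using (Rel)
open import Relation.Binary.Definitions using (_Respects_)
open import Relation.Binary.PropositionalEquality using (_≡_)
import Relation.Binary.PropositionalEquality as ≡
open import Relation.Binary.Structures using (IsStrictTotalOrder)
open import Relation.Nullary.Negation using (¬_)
open import Relation.Unary using (Pred; _∈_; _∉_; _⊆_; _≐_; _∩_; _∖_; _⊢_; Empty; Satisfiable)
open import Relation.Unary.Relation.Binary.Equality using (≐-setoid)

-- Cardinality is compared between setoids, so that sets of sets are counted
-- up to extensional equality and elements of a subset {x ∣ P x} up to
-- equality of x, ignoring the proof of P x.

module _ {a b c d : Level} where

  infix 4 _≈ᶜ_ _≺ᶜ_

  _≈ᶜ_ : Setoid a b → Setoid c d → Set (a ⊔ b ⊔ c ⊔ d)
  S ≈ᶜ T = Bijection S T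

  _≺ᶜ_ : Setoid a b → Setoid c d → Set (a ⊔ b ⊔ c ⊔ d)
  S ≺ᶜ T = Injection S T × ¬ Injection T S

Sub : ∀ {a b p} (S : Setoid a b) → Pred (Setoid.Carrier S) p → Setoid (a ⊔ p) b
Sub S P = On.setoid S (proj₁ {B = P})

Infinite : ∀ {a b} → Setoid a b → Set (a ⊔ b)
Infinite S = ∀ (n : ℕ) → ¬ (≡.setoid (Fin n) ≈ᶜ S)

record WellOrder (ℓ : Level) : Set (suc ℓ) where
  infix 4 _<_
  field
    Carrier            : Set ℓ
    _<_                : Rel Carrier ℓ
    isStrictTotalOrder : IsStrictTotalOrder _≡_ _<_
    wellFounded        : WellFounded _<_

-- The elements of a well-order 𝕆 play the role of the ordinals: α stands for
-- its order type, and, as a set, for the initial segment ↓ α of its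
-- predecessors. Since 𝕆 is arbitrary, each ordinal occurs in some 𝕆, and an
-- 𝕆 containing κ contains every ordinal below κ.
--
-- A function or sequence with domain κ is given by a total function on Ord of
-- which only the values at arguments below κ are ever used.

module Ordinals {ℓ : Level} (𝕆 : WellOrder ℓ) where

  open WellOrder 𝕆 public using (_<_) renaming (Carrier to Ord)
  open StrictToNonStrict (_≡_ {A = Ord}) _<_ public using (_≤_)

  SetOfOrd : Set (suc ℓ)
  SetOfOrd = Pred Ord ℓ

  Family : Set (suc ℓ)
  Family = Pred SetOfOrd ℓ

  ↓_ : Ord → SetOfOrd
  (↓ α) β = β < α

  ⟦_⟧ : SetOfOrd → Setoid ℓ ℓ
  ⟦ A ⟧ = Sub (≡.setoid Ord) A

  ⟦_⟧ᶠ : Family → Setoid (suc ℓ) ℓ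
  ⟦ 𝒜 ⟧ᶠ = Sub (≐-setoid Ord ℓ) 𝒜

  Least : ∀ {p} → Pred Ord p → Pred Ord (ℓ ⊔ p)
  Least P α = P α × (∀ β → β < α → ¬ P β)

  -- Cardinals are initial ordinals; the finite ones are included.
  IsCardinal : Pred Ord ℓ
  IsCardinal κ = Least (λ α → ⟦ ↓ α ⟧ ≈ᶜ ⟦ ↓ κ ⟧) κ

  IsCofinality : Ord → Pred Ord ℓ
  IsCofinality κ = Least λ β →
    Σ[ f ∈ (Ord → Ord) ]
      (∀ γ → γ < β → f γ < κ) ×
      (∀ α → α < κ → ∃[ γ ] γ < β × α ≤ f γ)

  IsInfiniteRegular : Pred Ord ℓ
  IsInfiniteRegular κ = IsCardinal κ × Infinite ⟦ ↓ κ ⟧ × IsCofinality κ κ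

  -- The set of functions from θ to 2, with pointwise equality.
  2^_ : Ord → Setoid ℓ ℓ
  2^ θ = FunctionSetoid.setoid ⟦ ↓ θ ⟧ (≡.setoid Bool)

  -- "γ = sup A"; the supremum of the empty set is the least ordinal.
  IsSup : SetOfOrd → Pred Ord ℓ
  IsSup A γ = (∀ α → α ∈ A → α ≤ γ) × (∀ δ → (∀ α → α ∈ A → α ≤ δ) → γ ≤ δ)

  -- sup (A ∩ α) = α > 0
  IsLimitPoint : SetOfOrd → Pred Ord ℓ
  IsLimitPoint A α = IsSup (A ∩ ↓ α) α × (∃[ β ] β < α)

  acc : SetOfOrd → SetOfOrd
  acc A = A ∩ IsLimitPoint A

  IsClosedSubset : SetOfOrd → Pred Ord ℓ
  IsClosedSubset C α = (C ⊆ ↓ α) × (∀ β → β < α → IsLimitPoint C β → β ∈ C)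

  IsClub : SetOfOrd → Pred Ord ℓ
  IsClub D κ = IsClosedSubset D κ × (∀ α → α < κ → ∃[ β ] β ∈ D × α ≤ β)

  record IsSquareSequence (κ : Ord) (𝒞 : Ord → Family) : Set (suc ℓ) where
    field
      extensional : ∀ α → α < κ → 𝒞 α Respects _≐_
      nonempty    : ∀ α → α < κ → Satisfiable (𝒞 α)
      small       : ∀ α → α < κ → ⟦ 𝒞 α ⟧ᶠ ≺ᶜ ⟦ ↓ κ ⟧
      closed      : ∀ α → α < κ → ∀ C → C ∈ 𝒞 α → IsClosedSubset C α
      sup-C≡sup-α : ∀ α → α < κ → ∀ C → C ∈ 𝒞 α →
                    ∃[ γ ] IsSup C γ × IsSup (↓ α) γ
      coherent    : ∀ α → α < κ → ∀ C → C ∈ 𝒞 α →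
                    ∀ ᾱ → ᾱ ∈ acc C → (C ∩ ↓ ᾱ) ∈ 𝒞 ᾱ
      unthreaded  : ¬ (∃[ D ] IsClub D κ × (∀ α → α ∈ acc D → (D ∩ ↓ α) ∈ 𝒞 α))

  IsTransversal : Ord → (Ord → SetOfOrd) → Set (suc ℓ)
  IsTransversal κ C =
    ∃[ 𝒞 ] IsSquareSequence κ 𝒞 × (∀ α → α < κ → C α ∈ 𝒞 α)

  -- A ∈ [κ]^χ
  _∈[_]^_ : SetOfOrd → Ord → Ord → Set ℓ
  A ∈[ κ ]^ χ = (A ⊆ ↓ κ) × (⟦ A ⟧ ≈ᶜ ⟦ ↓ χ ⟧)

  -- "χ = χ(C)" for C = ⟨ C_β ∣ β < κ ⟩
  IsChi : Ord → (Ord → SetOfOrd) → Pred Ord (suc ℓ)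
  IsChi κ C = Least λ χ → IsCardinal χ × χ ≤ κ ×
    (Σ[ Δ ∈ SetOfOrd ] Σ[ b ∈ (Ord → SetOfOrd) ]
      (Δ ∈[ κ ]^ κ) ×
      (∀ α → α < κ → b α ∈[ κ ]^ χ) ×
      (∀ α → α < κ → ∀ δ → δ ∈ (Δ ∩ ↓ α) → ∃[ β ] β ∈ b α × δ ∈ C β))

  record IsUltrafilter (κ : Ord) (𝒰 : Family) : Set (suc ℓ) where
    field
      subsets  : ∀ A → A ∈ 𝒰 → A ⊆ ↓ κ
      whole    : (↓ κ) ∈ 𝒰
      proper   : ∀ A → Empty A → A ∉ 𝒰
      upward   : ∀ A B → A ∈ 𝒰 → A ⊆ B → B ⊆ ↓ κ → B ∈ 𝒰
      ∩-closed : ∀ A B → A ∈ 𝒰 → B ∈ 𝒰 → (A ∩ B) ∈ 𝒰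
      ultra    : ∀ A → A ⊆ ↓ κ → A ∈ 𝒰 ⊎ (↓ κ ∖ A) ∈ 𝒰

  IsUniform : Ord → Family → Set (suc ℓ)
  IsUniform κ 𝒰 = ∀ A → A ∈ 𝒰 → ⟦ A ⟧ ≈ᶜ ⟦ ↓ κ ⟧

  IsIndecomposable : Ord → Family → Ord → Set (suc ℓ)
  IsIndecomposable κ 𝒰 μ =
    ∀ (f : Ord → Ord) → (∀ α → α < κ → f α < μ) →
    Σ[ H ∈ SetOfOrd ] (H ⊆ ↓ μ) × (⟦ H ⟧ ≺ᶜ ⟦ ↓ μ ⟧) × (↓ κ ∩ f ⊢ H) ∈ 𝒰

{-# OPTIONS --safe #-}

-- Write ∀*β for "𝒰-almost every β < κ".  Everything rests on one closure argument: every
-- F : κ → κ has closure points ε < κ that are suprema of increasing θ-sequences, and since 𝒰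
-- is θ-indecomposable, a function that is below such an ε almost everywhere is bounded below
-- ε almost everywhere.
--
-- Fix a transversal C and walk from β down to δ by γ ↦ min (C γ ∖ δ).  By the closure argument
-- there is a δ such that, for unboundedly many ν, almost every walk to δ steps over ν from a
-- point γ with ν ∈ C γ, and by the same argument this γ = h(β) does not depend on ν almost
-- everywhere.  So ∀*β ν ∈ C (h β) for unboundedly many ν; a closure point ε of these ν
-- satisfies ∀*β ε ∈ acc (C (h β)).
--
-- For such ε the sets C (h β) ∩ ε lie in 𝒞 ε, which has fewer than κ elements, so by
-- indecomposability they take fewer than θ values almost everywhere.  If they take at most μ
-- values for unboundedly many ε, then χ(C) ≤ μ.  Were there a counterexample C for each cardinal
-- μ < θ, the product of the θ many resulting classifications β ↦ C (h β) ∩ ε would have at most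
-- 2^θ < κ values, hence some number μ < θ of values almost everywhere, which contradicts the
-- choice of the counterexample for this μ.

module Submission where

open import Defs
open import Axiom.DoubleNegationElimination using (em⇒dne)
open import Axiom.ExcludedMiddle using (ExcludedMiddle)
open import Axiom.Extensionality.Propositional using (Extensionality; implicit-extensionality)
open import Data.Empty using (⊥-elim)
open import Data.Fin.Patterns using (0F)
open import Data.Product.Base using (Σ; Σ-syntax; ∃-syntax; _×_; _,_; proj₁; proj₂)
open import Data.Sum.Base using (inj₁; inj₂)
open import Function.Base using (_∘_; id)
open import Function.Bundles using (Injection; Bijection)
open import Induction.WellFounded using (WfRec; module All; module FixPoint)
open import Level using (Level; _⊔_)
open import Relation.Binary.Bundles using (Setoid)
open import Relation.Binary.Definitions using (tri<; tri≈; tri>)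
open import Relation.Binary.PropositionalEquality using (_≡_; refl; sym; trans; cong; subst)
import Relation.Binary.PropositionalEquality as ≡
open import Relation.Binary.Structures using (IsStrictTotalOrder)
open import Relation.Nullary using (does; yes; no; ¬_)
open import Relation.Unary using (Pred; _∈_; _⊆_; _∩_)

-- Classical logic.

module Classical (em : ∀ {a} → ExcludedMiddle a) where

  opaque
    dne : ∀ {a} {P : Set a} → ¬ ¬ P → P
    dne = em⇒dne em

    ¬∀⇒∃ : ∀ {a b} {A : Set a} {B : A → Set b} → ¬ (∀ x → B x) → ∃[ x ] ¬ B x
    ¬∀⇒∃ ¬∀ = dne λ ¬∃ → ¬∀ λ x → dne λ ¬b → ¬∃ (x , ¬b)

    ¬∀∈⇒∃ : ∀ {a b c} {A : Set a} {P : A → Set b} {Q : A → Set c} →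
            ¬ (∀ x → P x → Q x) → ∃[ x ] P x × ¬ Q x
    ¬∀∈⇒∃ ¬∀ = dne λ ¬∃ → ¬∀ λ x p → dne λ ¬q → ¬∃ (x , p , ¬q)

-- Order, least elements, choice and recursion on the ordinals.

module WellOrdered (em : ∀ {a} → ExcludedMiddle a) (ext : ∀ {a b} → Extensionality a b)
                   {ℓ : Level} (𝕆 : WellOrder ℓ) where

  open Ordinals 𝕆 public
  open WellOrder 𝕆 public using (wellFounded)
  open IsStrictTotalOrder (WellOrder.isStrictTotalOrder 𝕆) public
    using (compare; irrefl) renaming (trans to <-trans)
  open Classical em public

  <-irrefl : ∀ {α} → ¬ (α < α)
  <-irrefl = irrefl refl

  ≤-refl : ∀ {α} → α ≤ α
  ≤-refl = inj₂ refl

  ≤-<-trans : ∀ {α β γ} → α ≤ β → β < γ → α < γ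
  ≤-<-trans (inj₁ p) q = <-trans p q
  ≤-<-trans (inj₂ refl) q = q

  <-≤-trans : ∀ {α β γ} → α < β → β ≤ γ → α < γ
  <-≤-trans p (inj₁ q) = <-trans p q
  <-≤-trans p (inj₂ refl) = p

  ≤-trans : ∀ {α β γ} → α ≤ β → β ≤ γ → α ≤ γ
  ≤-trans (inj₁ p) q = inj₁ (<-≤-trans p q)
  ≤-trans (inj₂ refl) q = q

  ≮⇒≥ : ∀ {α β} → ¬ (α < β) → β ≤ α
  ≮⇒≥ {α} {β} α≮β with compare α β
  ... | tri< p _ _ = ⊥-elim (α≮β p)
  ... | tri≈ _ p _ = inj₂ (sym p)
  ... | tri> _ _ p = inj₁ p

  ≰⇒> : ∀ {α β} → ¬ (α ≤ β) → β < α
  ≰⇒> {α} {β} α≰β with compare α β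
  ... | tri< p _ _ = ⊥-elim (α≰β (inj₁ p))
  ... | tri≈ _ p _ = ⊥-elim (α≰β (inj₂ p))
  ... | tri> _ _ p = p

  ≤⇒≯ : ∀ {α β} → α ≤ β → ¬ (β < α)
  ≤⇒≯ p q = <-irrefl (≤-<-trans p q)

  ≤-antisym : ∀ {α β} → α ≤ β → β ≤ α → α ≡ β
  ≤-antisym (inj₂ p) _ = p
  ≤-antisym (inj₁ p) q = ⊥-elim (≤⇒≯ q p)

  upper : ∀ α β → ∃[ γ ] α ≤ γ × β ≤ γ × (∀ {δ} → α < δ → β < δ → γ < δ)
  upper α β with compare α β
  ... | tri< p _ _ = β , inj₁ p , ≤-refl , λ _ q → q
  ... | tri≈ _ p _ = β , inj₂ p , ≤-refl , λ _ q → q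
  ... | tri> _ _ p = α , ≤-refl , inj₁ p , λ q _ → q

  opaque
    least : ∀ {p} {P : Pred Ord p} → ∃[ α ] P α → ∃[ α ] Least P α
    least {p} {P} (α , pα) = All.wfRec wellFounded _ (λ α → P α → ∃[ β ] Least P β) step α pα
      where
      step : ∀ α → WfRec _<_ (λ α → P α → ∃[ β ] Least P β) α → P α → ∃[ β ] Least P β
      step α rec pα with em {P = ∃[ β ] β < α × P β}
      ... | yes (β , β<α , pβ) = rec β<α pβ
      ... | no none = α , pα , λ β β<α pβ → none (β , β<α , pβ)

  Least⇒≤ : ∀ {p} {P : Pred Ord p} {α β} → Least P α → P β → α ≤ β
  Least⇒≤ (_ , min) pβ = ≮⇒≥ λ β<α → min _ β<α pβ

  opaque
    -- Total, with `d` as the value where `P` is empty, so that functions obtained by choice are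
    -- maps on all of `Ord`.
    choose : ∀ {p} → Pred Ord p → Ord → Ord
    choose P d with em {P = ∃[ α ] P α}
    ... | yes (α , _) = α
    ... | no _ = d

    choose-∈ : ∀ {p} (P : Pred Ord p) {d} → ∃[ α ] P α → P (choose P d)
    choose-∈ P e with em {P = ∃[ α ] P α}
    ... | yes (_ , pα) = pα
    ... | no none = ⊥-elim (none e)

    choose-elim : ∀ {p q} {P : Pred Ord p} {Q : Pred Ord q} {d} →
                  (∀ {α} → P α → Q α) → Q d → Q (choose P d)
    choose-elim {P = P} P⇒Q qd with em {P = ∃[ α ] P α}
    ... | yes (_ , pα) = P⇒Q pα
    ... | no _ = qd

  module Recursion (step : (α : Ord) → ((β : Ord) → β < α → Ord) → Ord) where

    private
      f : ∀ α → WfRec _<_ (λ _ → Ord) α → Ord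
      f α ih = step α (λ β β<α → ih β<α)

      f-ext : ∀ α {ih ih′ : WfRec _<_ (λ _ → Ord) α} →
              (∀ {β} β<α → ih {β} β<α ≡ ih′ β<α) → f α ih ≡ f α ih′
      f-ext α eq = cong (f α) (implicit-extensionality ext (ext eq))

    opaque
      rec : Ord → Ord
      rec = All.wfRec wellFounded ℓ (λ _ → Ord) f

      unfold : ∀ α → rec α ≡ step α (λ β _ → rec β)
      unfold α = FixPoint.unfold-wfRec wellFounded (λ _ → Ord) f f-ext

  -- Bijections between sets of ordinals.

  -- The values of to outside A and of from outside B are arbitrary.
  infix 4 _≅_
  record _≅_ {p q} (A : Pred Ord p) (B : Pred Ord q) : Set (ℓ ⊔ p ⊔ q) where
    field
      to      : Ord → Ord
      from    : Ord → Ord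
      to-∈    : ∀ {α} → α ∈ A → to α ∈ B
      from-∈  : ∀ {β} → β ∈ B → from β ∈ A
      from-to : ∀ {α} → α ∈ A → from (to α) ≡ α
      to-from : ∀ {β} → β ∈ B → to (from β) ≡ β

  open _≅_

  ≅-refl : ∀ {p} {A : Pred Ord p} → A ≅ A
  ≅-refl = record { to = id ; from = id ; to-∈ = id ; from-∈ = id
                  ; from-to = λ _ → refl ; to-from = λ _ → refl }

  ≅-sym : ∀ {p q} {A : Pred Ord p} {B : Pred Ord q} → A ≅ B → B ≅ A
  ≅-sym e = record { to = from e ; from = to e ; to-∈ = from-∈ e ; from-∈ = to-∈ e
                   ; from-to = to-from e ; to-from = from-to e }

  ≅-trans : ∀ {p q r} {A : Pred Ord p} {B : Pred Ord q} {C : Pred Ord r} →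
            A ≅ B → B ≅ C → A ≅ C
  ≅-trans e f = record
    { to = to f ∘ to e ; from = from e ∘ from f
    ; to-∈ = to-∈ f ∘ to-∈ e ; from-∈ = from-∈ e ∘ from-∈ f
    ; from-to = λ p → trans (cong (from e) (from-to f (to-∈ e p))) (from-to e p)
    ; to-from = λ p → trans (cong (to f) (to-from e (from-∈ f p))) (to-from f p) }

  ≅-restrict : ∀ {p q r} {A : Pred Ord p} {B : Pred Ord q} (e : A ≅ B) (P : Pred Ord r) →
               P ⊆ B → (λ α → α ∈ A × to e α ∈ P) ≅ P
  ≅-restrict e P P⊆B = record
    { to = to e ; from = from e ; to-∈ = proj₂
    ; from-∈ = λ p → from-∈ e (P⊆B p) , subst P (sym (to-from e (P⊆B p))) p
    ; from-to = from-to e ∘ proj₁ ; to-from = to-from e ∘ P⊆B }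

  ≅-image : ∀ {p} {A : Pred Ord p} (f : Ord → Ord) →
            (∀ {α β} → α ∈ A → β ∈ A → f α ≡ f β → α ≡ β) →
            A ≅ λ β → ∃[ α ] α ∈ A × f α ≡ β
  ≅-image {A = A} f inj = record
    { to = f ; from = g ; to-∈ = λ {α} p → α , p , refl ; from-∈ = λ q → proj₁ (spec q)
    ; from-to = λ {α} p → let r = spec (α , p , refl) in inj (proj₁ r) p (proj₂ r)
    ; to-from = λ q → proj₂ (spec q) }
    where
    g : Ord → Ord
    g β = choose (λ α → α ∈ A × f α ≡ β) β
    spec : ∀ {β} → (∃[ α ] α ∈ A × f α ≡ β) → g β ∈ A × f (g β) ≡ β
    spec {β} = choose-∈ (λ α → α ∈ A × f α ≡ β)

  S⟦_⟧ : ∀ {p} → Pred Ord p → Setoid (ℓ ⊔ p) ℓ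
  S⟦ A ⟧ = Sub (≡.setoid Ord) A

  ≅⇒Bijection : ∀ {p q} {A : Pred Ord p} {B : Pred Ord q} → A ≅ B → Bijection S⟦ A ⟧ S⟦ B ⟧
  ≅⇒Bijection e = record
    { to = λ (α , p) → to e α , to-∈ e p
    ; cong = cong (to e)
    ; bijective = (λ { {α , p} {β , q} eq →
                      trans (sym (from-to e p)) (trans (cong (from e) eq) (from-to e q)) })
                , λ (β , q) → (from e β , from-∈ e q) , λ { refl → to-from e q } }

  -- Equality in `Sub` ignores membership proofs, so `F.to` gives the same ordinal for whichever
  -- proof excluded middle supplies in `f`.
  Bijection⇒≅ : ∀ {p q} {A : Pred Ord p} {B : Pred Ord q} → Bijection S⟦ A ⟧ S⟦ B ⟧ → A ≅ B
  Bijection⇒≅ {A = A} {B} F = record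
    { to = f ; from = g ; to-∈ = f-∈ ; from-∈ = proj₁ ∘ spec
    ; from-to = λ p → f-injective (proj₁ (spec (f-∈ p))) p (proj₂ (spec (f-∈ p)))
    ; to-from = proj₂ ∘ spec }
    where
    module F = Bijection F
    f : Ord → Ord
    f α with em {P = α ∈ A}
    ... | yes p = proj₁ (F.to (α , p))
    ... | no _ = α
    f-∈ : ∀ {α} → α ∈ A → f α ∈ B
    f-∈ {α} p with em {P = α ∈ A}
    ... | yes p′ = proj₂ (F.to (α , p′))
    ... | no ¬p = ⊥-elim (¬p p)
    f-≡ : ∀ {α} (p : α ∈ A) → f α ≡ proj₁ (F.to (α , p))
    f-≡ {α} p with em {P = α ∈ A}
    ... | yes _ = F.cong refl
    ... | no ¬p = ⊥-elim (¬p p)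
    f-injective : ∀ {α β} → α ∈ A → β ∈ A → f α ≡ f β → α ≡ β
    f-injective p q eq = F.injective {_ , p} {_ , q} (trans (sym (f-≡ p)) (trans eq (f-≡ q)))
    g : Ord → Ord
    g β = choose (λ α → α ∈ A × f α ≡ β) β
    spec : ∀ {β} → β ∈ B → g β ∈ A × f (g β) ≡ β
    spec {β} q = choose-∈ (λ α → α ∈ A × f α ≡ β) (α , p , trans (f-≡ p) eq)
      where
      pre = F.strictlySurjective (β , q)
      α = proj₁ (proj₁ pre)
      p = proj₂ (proj₁ pre)
      eq = proj₂ pre

  ≅⇒Injection : ∀ {p q} {A : Pred Ord p} {B : Pred Ord q} → A ≅ B → Injection S⟦ A ⟧ S⟦ B ⟧
  ≅⇒Injection = Bijection.injection ∘ ≅⇒Bijection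

  cardinal-≤ : ∀ {κ δ} → IsCardinal κ → (↓ δ) ≅ (↓ κ) → κ ≤ δ
  cardinal-≤ card e = Least⇒≤ card (≅⇒Bijection e)

  Least≅⇒cardinal : ∀ {p} {P : Pred Ord p} {κ} → Least P κ →
                    (∀ {δ} → (↓ δ) ≅ (↓ κ) → P δ) → IsCardinal κ
  Least≅⇒cardinal lst resp =
    ≅⇒Bijection ≅-refl , λ δ δ<κ bij → proj₂ lst δ δ<κ (resp (Bijection⇒≅ bij))

  -- Order types and cardinalities.

  module Collapse {p} (A : Pred Ord p) where

    private
      Above : (α : Ord) → ((β : Ord) → β < α → Ord) → Pred Ord (ℓ ⊔ p)
      Above α ih γ = ∀ β (β<α : β < α) → β ∈ A → ih β β<α < γ

      -- `rank α` is the order type of `A ∩ ↓ α`, whether or not `α` lies in `A`.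
      open Recursion (λ α ih → choose (Least (Above α ih)) α) renaming (rec to rank)

      -- Both halves go by one induction: `rank β ≤ β < α` makes `α` itself a strict upper bound, so
      -- the least one exists.
      spec : ∀ α → rank α ≤ α × Least (Above α (λ β _ → rank β)) (rank α)
      spec = All.wfRec wellFounded _ _ λ α ih →
        let above = λ β β<α _ → ≤-<-trans (proj₁ (ih β<α)) β<α
            lst = subst (Least (Above α (λ β _ → rank β))) (sym (unfold α))
                    (choose-∈ (Least (Above α (λ β _ → rank β))) (least (α , above)))
        in Least⇒≤ lst above , lst

    rank-≤ : ∀ α → rank α ≤ α
    rank-≤ = proj₁ ∘ spec

    rank-mono : ∀ {α β} → β ∈ A → β < α → rank β < rank α
    rank-mono q β<α = proj₁ (proj₂ (spec _)) _ β<α q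

    rank-injective : ∀ {α β} → α ∈ A → β ∈ A → rank α ≡ rank β → α ≡ β
    rank-injective {α} {β} p q eq with compare α β
    ... | tri< lt _ _ = ⊥-elim (irrefl eq (rank-mono p lt))
    ... | tri≈ _ α≡β _ = α≡β
    ... | tri> _ _ gt = ⊥-elim (irrefl (sym eq) (rank-mono q gt))

    below-rank : ∀ {α γ} → γ < rank α → ∃[ β ] β < α × β ∈ A × γ ≤ rank β
    below-rank {α} {γ} γ< = dne λ none → proj₂ (proj₂ (spec α)) γ γ< λ β β<α q →
      ≰⇒> λ γ≤ → none (β , β<α , q , γ≤)

    rank-onto : ∀ α {γ} → α ∈ A → γ ≤ rank α → ∃[ β ] β ∈ A × rank β ≡ γ
    rank-onto = All.wfRec wellFounded _
      (λ α → ∀ {γ} → α ∈ A → γ ≤ rank α → ∃[ β ] β ∈ A × rank β ≡ γ) λ where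
        α ih p (inj₂ eq) → α , p , sym eq
        α ih p (inj₁ lt) → let β , β<α , q , le = below-rank lt in ih β<α q le

    -- By `rank-onto` the ranks of elements of `A` form an initial segment; `δ` is its least strict
    -- upper bound.
    collapse : ∀ {λ′} → A ⊆ (↓ λ′) → ∃[ δ ] δ ≤ λ′ × A ≅ (↓ δ)
    collapse {λ′} A⊆ = δ , Least⇒≤ lst (λ α p → ≤-<-trans (rank-≤ α) (A⊆ p)) ,
                      ≅-trans (≅-image rank rank-injective) image≅
      where
      bound = least {P = λ γ → ∀ α → α ∈ A → rank α < γ} (λ′ , λ α p → ≤-<-trans (rank-≤ α) (A⊆ p))
      δ = proj₁ bound
      lst = proj₂ bound
      onto : ∀ {γ} → γ < δ → ∃[ α ] α ∈ A × rank α ≡ γ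
      onto {γ} γ<δ = let α , p , ≮ = ¬∀∈⇒∃ (proj₂ lst γ γ<δ) in rank-onto α p (≮⇒≥ ≮)
      image≅ : (λ γ → ∃[ α ] α ∈ A × rank α ≡ γ) ≅ (↓ δ)
      image≅ = record
        { to = id ; from = id ; to-∈ = λ { (α , p , refl) → proj₁ lst α p } ; from-∈ = onto
        ; from-to = λ _ → refl ; to-from = λ _ → refl }

  open Collapse using (collapse) public

  opaque
    -- Choosing an index below `μ` for each element embeds `A` into `μ`; the collapse bounds its
    -- order type, and the least ordinal equinumerous with `A` is a cardinal.
    cardinality : ∀ {p} (A : Pred Ord p) (v : Ord → Ord) {μ} →
                  (∀ {β} → β ∈ A → ∃[ i ] i < μ × v i ≡ β) →
                  ∃[ χ ] IsCardinal χ × χ ≤ μ × A ≅ (↓ χ)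
    cardinality A v {μ} onto = finish (collapse (λ i → ∃[ β ] β ∈ A × index β ≡ i)
                                         λ { (_ , p , refl) → proj₁ (index-spec p) })
      where
      index : Ord → Ord
      index β = choose (λ i → i < μ × v i ≡ β) β
      index-spec : ∀ {β} → β ∈ A → index β < μ × v (index β) ≡ β
      index-spec {β} p = choose-∈ (λ i → i < μ × v i ≡ β) (onto p)
      index-injective : ∀ {α β} → α ∈ A → β ∈ A → index α ≡ index β → α ≡ β
      index-injective p q eq =
        trans (sym (proj₂ (index-spec p))) (trans (cong v eq) (proj₂ (index-spec q)))
      minimal : ∀ {δ} → A ≅ (↓ δ) → ∃[ χ ] Least (λ χ → A ≅ (↓ χ)) χ →
                ∃[ χ ] IsCardinal χ × χ ≤ δ × A ≅ (↓ χ)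
      minimal A≅δ (χ , lst) =
        χ , Least≅⇒cardinal lst (λ e → ≅-trans (proj₁ lst) (≅-sym e)) , Least⇒≤ lst A≅δ , proj₁ lst
      finish : ∃[ δ ] δ ≤ μ × (λ i → ∃[ β ] β ∈ A × index β ≡ i) ≅ (↓ δ) →
               ∃[ χ ] IsCardinal χ × χ ≤ μ × A ≅ (↓ χ)
      finish (δ , δ≤μ , e) =
        let A≅δ = ≅-trans (≅-image index index-injective) e
            χ , χ-card , χ≤δ , A≅χ = minimal A≅δ (least (δ , A≅δ))
        in χ , χ-card , ≤-trans χ≤δ δ≤μ , A≅χ

  -- Regular cardinals.

  Unbounded : ∀ {p} → Pred Ord p → Ord → Set (ℓ ⊔ p)
  Unbounded A κ = ∀ α → α < κ → ∃[ β ] β ∈ A × α ≤ β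

  module Regular {ρ : Ord} (reg : IsInfiniteRegular ρ) where

    isCardinal : IsCardinal ρ
    isCardinal = proj₁ reg

    opaque
      -- As `ρ` is its own cofinality, `f` is not cofinal on `η`; an ordinal that it fails to reach
      -- is the bound.
      bound : ∀ {η} (f : Ord → Ord) → η < ρ → (∀ {γ} → γ < η → f γ < ρ) →
              ∃[ ζ ] ζ < ρ × (∀ {γ} → γ < η → f γ < ζ)
      bound {η} f η<ρ f< =
        let ζ , ζ<ρ , none = ¬∀∈⇒∃ λ cof → proj₂ (proj₂ (proj₂ reg)) η η<ρ (f , (λ γ → f<) , cof)
        in ζ , ζ<ρ , λ {γ} γ<η → ≰⇒> λ le → none (γ , γ<η , le)

      inhabited : ∃[ ζ ] ζ < ρ
      inhabited = dne λ none → proj₁ (proj₂ reg) 0 record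
        { to = λ () ; cong = λ { {()} }
        ; bijective = (λ { {()} }) , λ (ζ , ζ<ρ) → ⊥-elim (none (ζ , ζ<ρ)) }

      limit : ∀ {α} → α < ρ → ∃[ β ] α < β × β < ρ
      limit {α} α<ρ with em {P = ∃[ ζ ] ζ < α}
      ... | yes (ζ , ζ<α) =
        let β , β<ρ , above = bound (λ _ → α) α<ρ (λ _ → α<ρ) in β , above ζ<α , β<ρ
      -- With `α` least and nothing above it, `↓ ρ` would have exactly one element.
      ... | no none = dne λ isMax → proj₁ (proj₂ reg) 1 record
        { to = λ _ → α , α<ρ ; cong = λ _ → refl
        ; bijective = (λ { {0F} {0F} _ → refl })
                    , λ (β , β<ρ) → 0F , λ _ → ≤-antisym (≮⇒≥ λ β<α → none (β , β<α))
                                                (≮⇒≥ λ α<β → isMax (β , α<β , β<ρ)) }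

      -- If the order type were some `δ < ρ`, the inverse of the collapse would map `δ` cofinally
      -- into `ρ`.
      unbounded-≅ : ∀ {p} {A : Pred Ord p} → A ⊆ (↓ ρ) → Unbounded A ρ → A ≅ (↓ ρ)
      unbounded-≅ {A = A} A⊆ unb = full (collapse A A⊆)
        where
        full : ∃[ δ ] δ ≤ ρ × A ≅ (↓ δ) → A ≅ (↓ ρ)
        full (_ , inj₂ refl , e) = e
        full (δ , inj₁ δ<ρ , e) =
          let ζ , ζ<ρ , above = bound (from e) δ<ρ (A⊆ ∘ from-∈ e)
              β , p , ζ≤β = unb ζ ζ<ρ
          in ⊥-elim (≤⇒≯ ζ≤β (subst (_< ζ) (from-to e p) (above (to-∈ e p))))

      -- An unbounded image has size `ρ`, and inverting `ι` on it would inject `ρ` into `S`.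
      small⇒bounded : ∀ {a b} {S : Setoid a b} (ι : Injection S S⟦ ↓ ρ ⟧) → ¬ Injection S⟦ ↓ ρ ⟧ S →
                      ∃[ ζ ] ζ < ρ × (∀ x → proj₁ (Injection.to ι x) < ζ)
      small⇒bounded {S = S} ι small = dne λ none → small (invert (unbounded-≅
          (λ { (x , refl) → proj₂ (Injection.to ι x) })
          (λ α α<ρ → let x , ≮ = ¬∀⇒∃ λ all → none (α , α<ρ , all) in _ , (x , refl) , ≮⇒≥ ≮)))
        where
        invert : (λ β → ∃[ x ] proj₁ (Injection.to ι x) ≡ β) ≅ (↓ ρ) → Injection S⟦ ↓ ρ ⟧ S
        invert e = record
          { to = λ (β , p) → proj₁ (from-∈ e p)
          ; cong = λ { {β , p} {_ , q} refl → Injection.injective ι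
                       (trans (proj₂ (from-∈ e p)) (sym (proj₂ (from-∈ e q)))) }
          ; injective = λ { {β , p} {γ , q} eq → trans (sym (to-from e p))
              (trans (cong (to e) (trans (sym (proj₂ (from-∈ e p)))
                (trans (Injection.cong ι eq) (proj₂ (from-∈ e q))))) (to-from e q)) } }

      chain : (G : Ord → Ord → Ord) → (∀ {j x} → j < ρ → x < ρ → G j x < ρ) → ∀ {α} → α < ρ →
              Σ[ ε ∈ (Ord → Ord) ] ∀ k → k < ρ →
                ε k < ρ × α ≤ ε k × (∀ j → j < k → G j (ε j) < ε k)
      chain G G< {α} α<ρ = rec , spec
        where
        Next : (k : Ord) → ((j : Ord) → j < k → Ord) → Pred Ord ℓ
        Next k ih γ = γ < ρ × α ≤ γ × (∀ j (j<k : j < k) → G j (ih j j<k) < γ)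
        open Recursion (λ k ih → choose (Next k ih) α)
        spec : ∀ k → k < ρ → Next k (λ j _ → rec j) (rec k)
        spec = All.wfRec wellFounded _ _ λ k ih k<ρ →
          let ζ , ζ<ρ , above = bound (λ j → G j (rec j)) k<ρ
                                  (λ j<k → let j<ρ = <-trans j<k k<ρ in G< j<ρ (proj₁ (ih j<k j<ρ)))
              γ , α≤γ , ζ≤γ , lub = upper α ζ
          in subst (Next k (λ j _ → rec j)) (sym (unfold k))
               (choose-∈ (Next k (λ j _ → rec j)) (γ , lub α<ρ ζ<ρ , α≤γ ,
                 λ j j<k → <-≤-trans (above j<k) ζ≤γ))

      -- Codes the disjoint union of the `↓ (ν μ)` inside `ρ`. The block of `μ` is an increasing
      -- sequence of length `ν μ` starting at or above `s μ`, and `s μ` lies above the ends of all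
      -- earlier blocks.
      disjoint-segments : ∀ (ν : Ord → Ord) → (∀ {μ} → μ < ρ → ν μ < ρ) →
        Σ[ e ∈ (Ord → Ord → Ord) ]
          (∀ {μ ξ} → μ < ρ → ξ < ν μ → e μ ξ < ρ) ×
          (∀ {μ μ′ ξ ξ′} → μ < ρ → μ′ < ρ → ξ < ν μ → ξ′ < ν μ′ → e μ ξ ≡ e μ′ ξ′ → μ ≡ μ′ × ξ ≡ ξ′)
      disjoint-segments ν ν<ρ = e , e<ρ , e-injective
        where
        segment : Ord → Ord → Ord
        segment x with em {P = x < ρ}
        ... | yes x<ρ = proj₁ (chain (λ _ y → y) (λ _ y<ρ → y<ρ) x<ρ)
        ... | no _ = id
        segment-spec : ∀ {x} → x < ρ → ∀ k → k < ρ →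
          segment x k < ρ × x ≤ segment x k × (∀ j → j < k → segment x j < segment x k)
        segment-spec {x} x<ρ with em {P = x < ρ}
        ... | yes x<ρ′ = proj₂ (chain (λ _ y → y) (λ _ y<ρ → y<ρ) x<ρ′)
        ... | no x≮ρ = ⊥-elim (x≮ρ x<ρ)
        End : Ord → Ord → Ord → Set ℓ
        End μ x z = z < ρ × (∀ {ξ} → ξ < ν μ → segment x ξ < z)
        end : Ord → Ord → Ord
        end μ x = choose (End μ x) x
        end-spec : ∀ {μ x} → μ < ρ → x < ρ → End μ x (end μ x)
        end-spec {μ} {x} μ<ρ x<ρ = choose-∈ (End μ x) (bound (segment x) (ν<ρ μ<ρ)
          λ {ξ} ξ<ν → proj₁ (segment-spec x<ρ ξ (<-trans ξ<ν (ν<ρ μ<ρ))))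
        starts : Σ[ s ∈ (Ord → Ord) ] ∀ k → k < ρ →
                   s k < ρ × proj₁ inhabited ≤ s k × (∀ j → j < k → end j (s j) < s k)
        starts = chain end (λ μ<ρ x<ρ → proj₁ (end-spec μ<ρ x<ρ)) (proj₂ inhabited)
        s : Ord → Ord
        s = proj₁ starts
        s<ρ : ∀ {μ} → μ < ρ → s μ < ρ
        s<ρ {μ} μ<ρ = proj₁ (proj₂ starts μ μ<ρ)
        e : Ord → Ord → Ord
        e μ ξ = segment (s μ) ξ
        spec : ∀ {μ ξ} → μ < ρ → ξ < ν μ →
          e μ ξ < ρ × s μ ≤ e μ ξ × (∀ j → j < ξ → e μ j < e μ ξ)
        spec {μ} {ξ} μ<ρ ξ<ν = segment-spec (s<ρ μ<ρ) ξ (<-trans ξ<ν (ν<ρ μ<ρ))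
        e<ρ : ∀ {μ ξ} → μ < ρ → ξ < ν μ → e μ ξ < ρ
        e<ρ μ<ρ ξ<ν = proj₁ (spec μ<ρ ξ<ν)
        apart : ∀ {μ μ′ ξ ξ′} → μ < ρ → μ′ < ρ → ξ < ν μ → ξ′ < ν μ′ → μ < μ′ → e μ ξ < e μ′ ξ′
        apart {μ} {μ′} μ<ρ μ′<ρ ξ<ν ξ′<ν μ<μ′ =
          <-trans (proj₂ (end-spec μ<ρ (s<ρ μ<ρ)) ξ<ν)
            (<-≤-trans (proj₂ (proj₂ (proj₂ starts μ′ μ′<ρ)) μ μ<μ′)
                        (proj₁ (proj₂ (spec μ′<ρ ξ′<ν))))
        e-injective : ∀ {μ μ′ ξ ξ′} → μ < ρ → μ′ < ρ → ξ < ν μ → ξ′ < ν μ′ →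
                      e μ ξ ≡ e μ′ ξ′ → μ ≡ μ′ × ξ ≡ ξ′
        e-injective {μ} {μ′} {ξ} {ξ′} μ<ρ μ′<ρ ξ<ν ξ′<ν eq with compare μ μ′
        ... | tri< lt _ _ = ⊥-elim (irrefl eq (apart μ<ρ μ′<ρ ξ<ν ξ′<ν lt))
        ... | tri> _ _ gt = ⊥-elim (irrefl (sym eq) (apart μ′<ρ μ<ρ ξ′<ν ξ<ν gt))
        ... | tri≈ _ refl _ with compare ξ ξ′
        ...   | tri< lt _ _ = ⊥-elim (irrefl eq (proj₂ (proj₂ (spec μ<ρ ξ′<ν)) ξ lt))
        ...   | tri> _ _ gt = ⊥-elim (irrefl (sym eq) (proj₂ (proj₂ (spec μ<ρ ξ<ν)) ξ′ gt))
        ...   | tri≈ _ ξ≡ξ′ _ = refl , ξ≡ξ′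

  -- Subsets of `θ` as elements of `2^ θ`.

  characteristic : (θ : Ord) → SetOfOrd → Setoid.Carrier (2^ θ)
  characteristic θ A = record { to = λ (γ , _) → does (em {P = A γ}) ; cong = λ { refl → refl } }

  does-≡⇒ : ∀ {A B : Set ℓ} → does (em {P = A}) ≡ does (em {P = B}) → A → B
  does-≡⇒ {A} {B} eq a with em {P = A} | em {P = B}
  ... | yes _ | yes b = b
  ... | no ¬a | _ = ⊥-elim (¬a a)

  -- If `κ ≤ θ`, the characteristic functions of singletons inject `κ` into `2^ θ`.
  <-2^ : ∀ {θ κ} → (2^ θ) ≺ᶜ ⟦ ↓ κ ⟧ → θ < κ
  <-2^ {θ} {κ} (_ , small) = ≰⇒> λ κ≤θ → small record
    { to = λ (α , _) → characteristic θ (α ≡_)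
    ; cong = λ { refl _ → refl }
    ; injective = λ { {_ , α<κ} eq → sym (does-≡⇒ (eq (_ , <-≤-trans α<κ κ≤θ)) refl) } }

-- The quantifier "for almost every β".

module Ultrafilters (em : ∀ {a} → ExcludedMiddle a) (ext : ∀ {a b} → Extensionality a b)
  {ℓ : Level} (𝕆 : WellOrder ℓ) {θ κ : WellOrder.Carrier 𝕆}
  (θ-regular : Ordinals.IsInfiniteRegular 𝕆 θ) (κ-regular : Ordinals.IsInfiniteRegular 𝕆 κ)
  (θ<κ : WellOrder._<_ 𝕆 θ κ) {𝒰 : Ordinals.Family 𝕆}
  (𝒰-ultrafilter : Ordinals.IsUltrafilter 𝕆 κ 𝒰) (𝒰-uniform : Ordinals.IsUniform 𝕆 κ 𝒰)
  (𝒰-indecomposable : ∀ μ → Ordinals.IsCardinal 𝕆 μ → Ordinals._≤_ 𝕆 θ μ →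
                      WellOrder._<_ 𝕆 μ κ → Ordinals.IsIndecomposable 𝕆 κ 𝒰 μ) where

  open WellOrdered em ext 𝕆
  open IsUltrafilter 𝒰-ultrafilter
  open _≅_
  module θ = Regular θ-regular
  module κ = Regular κ-regular

  ∀* : (Ord → Set ℓ) → Set ℓ
  ∀* P = (λ β → β < κ × P β) ∈ 𝒰

  private variable P Q : Ord → Set ℓ

  opaque
    ∀*-map : (∀ {β} → β < κ → P β → Q β) → ∀* P → ∀* Q
    ∀*-map f p = upward _ _ p (λ (β<κ , x) → β<κ , f β<κ x) proj₁

    ∀*-zip : ∀ {R : Ord → Set ℓ} → (∀ {β} → β < κ → P β → Q β → R β) → ∀* P → ∀* Q → ∀* R
    ∀*-zip f p q = upward _ _ (∩-closed _ _ p q) (λ ((β<κ , x) , (_ , y)) → β<κ , f β<κ x y) proj₁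

    ∀*-all : (∀ {β} → β < κ → P β) → ∀* P
    ∀*-all f = upward _ _ whole (λ β<κ → β<κ , f β<κ) proj₁

    ∀*⇒∃ : ∀* P → ∃[ β ] β < κ × P β
    ∀*⇒∃ p = dne λ none → proper _ (λ β q → none (β , q)) p

    ¬∀*⇒∀*¬ : ¬ ∀* P → ∀* (λ β → ¬ P β)
    ¬∀*⇒∀*¬ {P} ¬p with ultra (λ β → β < κ × P β) proj₁
    ... | inj₁ p = ⊥-elim (¬p p)
    ... | inj₂ q = upward _ _ q (λ (β<κ , ¬x) → β<κ , λ x → ¬x (β<κ , x)) proj₁

    -- Otherwise a set of ordinals below `ν` is in `𝒰`; its order type is at most `ν < κ`, against
    -- uniformity.
    ∀*-≥ : ∀ {ν} → ν < κ → ∀* (ν ≤_)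
    ∀*-≥ {ν} ν<κ = dne λ ¬≥ →
      let δ , δ≤ν , e = collapse (λ β → β < κ × ¬ ν ≤ β) (≰⇒> ∘ proj₂)
          κ≤δ = cardinal-≤ κ.isCardinal (≅-trans (≅-sym e) (Bijection⇒≅ (𝒰-uniform _ (¬∀*⇒∀*¬ ¬≥))))
      in ≤⇒≯ κ≤δ (≤-<-trans δ≤ν ν<κ)

    ∀*-> : ∀ {ν} → ν < κ → ∀* (ν <_)
    ∀*-> ν<κ = let ν′ , ν<ν′ , ν′<κ = κ.limit ν<κ in ∀*-map (λ _ → <-≤-trans ν<ν′) (∀*-≥ ν′<κ)

  -- Closure points of cofinality θ.

  -- For a function f, take R β η to be f β ≡ η.
  Continuous : Ord → Set (Level.suc ℓ)
  Continuous ε = ∀ (R : Ord → Ord → Set ℓ) → ∀* (λ β → ∃[ η ] η < ε × R β η) →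
                 ∃[ η ] η < ε × ∀* (λ β → ∃[ η′ ] η′ ≤ η × R β η′)

  record ClosurePoint (F : Ord → Ord) (α : Ord) : Set (Level.suc ℓ) where
    field
      ε          : Ord
      α<ε        : α < ε
      ε<κ        : ε < κ
      closed     : ∀ {δ} → δ < ε → F δ < ε
      limit      : ∀ {δ} → δ < ε → ∃[ δ′ ] δ < δ′ × δ′ < ε
      continuous : Continuous ε

  record CofinalChain (G : Ord → Ord) (α : Ord) : Set ℓ where
    field
      ε       : Ord
      ε<κ     : ε < κ
      s       : Ord → Ord
      s<ε     : ∀ {k} → k < θ → s k < ε
      α≤s     : ∀ {k} → k < θ → α ≤ s k
      Gs<s    : ∀ {j k} → j < k → k < θ → G (s j) < s k
      s-mono  : ∀ {j k} → j < k → k < θ → s j < s k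
      cofinal : ∀ {γ} → γ < ε → ∃[ k ] k < θ × γ ≤ s k

  cofinalChain : ∀ G → (∀ {x} → x < κ → G x < κ × x < G x) → ∀ {α} → α < κ → CofinalChain G α
  -- The chain has length `κ`. Its first `θ` terms are bounded below `κ`, and `ε` is their least
  -- strict upper bound.
  cofinalChain G G-spec {α} α<κ with κ.chain (λ _ → G) (λ _ x<κ → proj₁ (G-spec x<κ)) α<κ
  ... | s , spec with κ.bound s θ<κ (λ {k} k<θ → proj₁ (spec k (<-trans k<θ θ<κ)))
  ... | ζ , ζ<κ , s<ζ with least {P = λ γ → ∀ k → k < θ → s k < γ} (ζ , λ k → s<ζ)
  ... | ε , ε-least = record
    { ε = ε ; ε<κ = ≤-<-trans (Least⇒≤ ε-least λ k → s<ζ) ζ<κ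
    ; s = s ; s<ε = λ {k} → proj₁ ε-least k
    ; α≤s = λ {k} k<θ → proj₁ (proj₂ (spec k (<-trans k<θ θ<κ)))
    ; Gs<s = Gs<s
    ; s-mono = λ {j} j<k k<θ →
        <-trans (proj₂ (G-spec (proj₁ (spec j (<-trans j<k (<-trans k<θ θ<κ)))))) (Gs<s j<k k<θ)
    ; cofinal = λ {γ} γ<ε → let k , k<θ , ≮ = ¬∀∈⇒∃ (proj₂ ε-least γ γ<ε) in k , k<θ , ≮⇒≥ ≮ }
    where
    Gs<s : ∀ {j k} → j < k → k < θ → G (s j) < s k
    Gs<s {j} {k} j<k k<θ = proj₂ (proj₂ (spec k (<-trans k<θ θ<κ))) j j<k

  -- Indecomposability yields a set of fewer than `θ` values, which is bounded in the regular
  -- cardinal `θ`.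
  index-bounded : ∀ (g : Ord → Ord) → (∀ β → β < κ → g β < θ) → ∃[ ζ ] ζ < θ × ∀* (λ β → g β < ζ)
  index-bounded g g<θ with 𝒰-indecomposable θ θ.isCardinal ≤-refl θ<κ g g<θ
  ... | H , H⊆ , (_ , small) , g∈H
    with θ.small⇒bounded {S = ⟦ H ⟧}
           (record { to = λ (γ , p) → γ , H⊆ p ; cong = id ; injective = id }) small
  ... | ζ , ζ<θ , H<ζ = ζ , ζ<θ , ∀*-map (λ _ p → H<ζ (_ , p)) g∈H

  -- Send `β` to an index `k` for which some `η ≤ s k` satisfies `R β η`. These indices are almost
  -- always below one `ζ < θ`, so `s ζ` serves for almost every `β`.
  chain⇒continuous : ∀ {G α} (chain : CofinalChain G α) → Continuous (CofinalChain.ε chain)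
  chain⇒continuous chain R ∀*R with θ.inhabited
  ... | zero , zero<θ = finish (index-bounded g λ β _ → choose-elim {Q = _< θ} proj₁ zero<θ)
    where
    open CofinalChain chain
    Index : Ord → Ord → Set ℓ
    Index β k = k < θ × ∃[ η ] η ≤ s k × R β η
    g : Ord → Ord
    g β = choose (Index β) zero
    finish : ∃[ ζ ] ζ < θ × ∀* (λ β → g β < ζ) → ∃[ η ] η < ε × ∀* (λ β → ∃[ η′ ] η′ ≤ η × R β η′)
    finish (ζ , ζ<θ , g<ζ) = s ζ , s<ε ζ<θ , ∀*-zip pointwise ∀*R g<ζ
      where
      pointwise : ∀ {β} → β < κ → ∃[ η ] η < ε × R β η → g β < ζ → ∃[ η′ ] η′ ≤ s ζ × R β η′
      pointwise {β} _ (η , η<ε , r) gβ<ζ =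
        let k , k<θ , η≤ = cofinal η<ε
            _ , η′ , η′≤ , r′ = choose-∈ (Index β) (k , k<θ , η , η≤ , r)
        in η′ , ≤-trans η′≤ (inj₁ (s-mono gβ<ζ ζ<θ)) , r′

  opaque
    closurePoint : ∀ F → (∀ {α} → α < κ → F α < κ) → ∀ {α} → α < κ → ClosurePoint F α
    closurePoint F F< {α} α<κ = record
      { ε = ε ; ε<κ = ε<κ
      ; α<ε = let _ , k<θ = θ.inhabited in ≤-<-trans (α≤s k<θ) (s<ε k<θ)
      ; closed = λ δ<ε → let k , k<θ , δ≤ = cofinal δ<ε ; k′ , k<k′ , k′<θ = θ.limit k<θ in
          <-trans (proj₂ (proj₂ (G-next (<-trans (s<ε k<θ) ε<κ))) _ δ≤)
            (<-trans (Gs<s k<k′ k′<θ) (s<ε k′<θ))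
      ; limit = λ δ<ε → let k , k<θ , δ≤ = cofinal δ<ε ; k′ , k<k′ , k′<θ = θ.limit k<θ in
          s k′ , ≤-<-trans δ≤ (s-mono k<k′ k′<θ) , s<ε k′<θ
      ; continuous = chain⇒continuous chain }
      where
      -- `F` need not be monotone, so `Next x` bounds it on all of `[0, x]`. If `δ ≤ s k`, then
      -- `F δ < G (s k) < s k′ < ε` for `k < k′`.
      Next : Ord → Ord → Set ℓ
      Next x z = z < κ × x < z × (∀ δ → δ ≤ x → F δ < z)
      G : Ord → Ord
      G x = choose (Next x) x
      G-next : ∀ {x} → x < κ → Next x (G x)
      G-next {x} x<κ = choose-∈ (Next x)
        (let x′ , x<x′ , x′<κ = κ.limit x<κ
             ζ , ζ<κ , F<ζ = κ.bound F x′<κ (λ γ<x′ → F< (<-trans γ<x′ x′<κ))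
             z , x′≤z , ζ≤z , lub = upper x′ ζ
         in z , lub x′<κ ζ<κ , <-≤-trans x<x′ x′≤z ,
            λ δ δ≤x → <-≤-trans (F<ζ (≤-<-trans δ≤x x<x′)) ζ≤z)
      chain : CofinalChain G α
      chain = cofinalChain G (λ x<κ → proj₁ (G-next x<κ) , proj₁ (proj₂ (G-next x<κ))) α<κ
      open CofinalChain chain

  -- The number of values taken almost everywhere.

  FewValues : (Ord → Ord) → Ord → Set (Level.suc ℓ)
  FewValues f δ = Σ[ H ∈ SetOfOrd ] H ≅ (↓ δ) × ∀* (λ β → f β ∈ H)

  opaque
    -- Apply indecomposability at `δ` to the index of `f β` under `H ≅ ↓ δ`. The resulting `H′` is
    -- smaller than `δ`, so its order type is below `δ`.
    fewer-values : ∀ {f δ} → IsCardinal δ → θ ≤ δ → δ < κ → FewValues f δ →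
                   ∃[ δ′ ] δ′ < δ × FewValues f δ′
    fewer-values {f} {δ} cardinal θ≤δ δ<κ (H , e , f∈H) with θ.inhabited
    ... | zero , zero<θ = finish (𝒰-indecomposable δ cardinal θ≤δ δ<κ g
                                    λ β _ → choose-elim {Q = _< δ} proj₁ (<-≤-trans zero<θ θ≤δ))
      where
      -- The clause `γ < δ` together with the default `zero` keeps `g` below `δ` even where `f β` is
      -- outside `H`.
      Code : Ord → Ord → Set ℓ
      Code β γ = γ < δ × γ ≡ to e (f β)
      g : Ord → Ord
      g β = choose (Code β) zero
      finish : Σ[ H′ ∈ SetOfOrd ] H′ ⊆ (↓ δ) × (⟦ H′ ⟧ ≺ᶜ ⟦ ↓ δ ⟧) × ∀* (λ β → g β ∈ H′) →
               ∃[ δ′ ] δ′ < δ × FewValues f δ′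
      finish (H′ , H′⊆ , (_ , small) , g∈H′) = shrink (collapse H′ H′⊆)
        where
        f∈ : ∀* (λ β → f β ∈ H × to e (f β) ∈ H′)
        f∈ = ∀*-zip (λ {β} _ p q →
          p , subst H′ (proj₂ (choose-∈ (Code β) (_ , to-∈ e p , refl))) q) f∈H g∈H′
        shrink : ∃[ δ′ ] δ′ ≤ δ × H′ ≅ (↓ δ′) → ∃[ δ′ ] δ′ < δ × FewValues f δ′
        shrink (_ , inj₂ refl , e′) = ⊥-elim (small (≅⇒Injection (≅-sym e′)))
        shrink (δ′ , inj₁ δ′<δ , e′) =
          δ′ , δ′<δ , _ , ≅-trans (≅-restrict e H′ H′⊆) e′ , f∈

  opaque
    -- The least possible number of values is a cardinal, and `fewer-values` would lower it if it
    -- were at least `θ`.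
    few-values : ∀ (f : Ord → Ord) {ν} → ν < κ → ∀* (λ β → f β < ν) →
                 ∃[ δ ] IsCardinal δ × δ < θ × FewValues f δ
    few-values f {ν} ν<κ f<ν with least {P = FewValues f} (ν , (↓ ν) , ≅-refl , f<ν)
    ... | δ , δ-least@((H , e , f∈H) , minimal) = δ , cardinal , δ<θ , proj₁ δ-least
      where
      cardinal : IsCardinal δ
      cardinal = Least≅⇒cardinal δ-least λ d → H , ≅-trans e (≅-sym d) , f∈H
      δ<θ : δ < θ
      δ<θ = ≰⇒> λ θ≤δ →
        let δ<κ = ≤-<-trans (Least⇒≤ δ-least ((↓ ν) , ≅-refl , f<ν)) ν<κ
            δ′ , δ′<δ , few = fewer-values cardinal θ≤δ δ<κ (proj₁ δ-least)
        in minimal δ′ δ′<δ few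

  -- Walks along C.

  module Walks (C : Ord → SetOfOrd) (C-closed : ∀ {γ} → γ < κ → IsClosedSubset (C γ) γ)
               (C-sup : ∀ {γ} → γ < κ → ∃[ ζ ] IsSup (C γ) ζ × IsSup (↓ γ) ζ) where

    opaque
      -- If `C γ` were contained in `↓ δ`, then `sup (C γ) = sup γ ≥ δ` would make `δ` a limit point
      -- of `C γ`, hence a member. Here and below `ζ` only witnesses that the ordinal above it is
      -- positive.
      member-≥ : ∀ {ζ δ γ} → ζ < δ → δ < γ → γ < κ → ∃[ ξ ] ξ ∈ C γ × δ ≤ ξ
      member-≥ {ζ} {δ} {γ} ζ<δ δ<γ γ<κ with C-sup γ<κ
      ... | σ , (σ-upper , σ-least) , (σ-above , _) = dne λ none →
        let C<δ = λ {ξ} (p : ξ ∈ C γ) → ≰⇒> λ δ≤ξ → none (ξ , p , δ≤ξ)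
            limitPoint = ((λ _ p → inj₁ (proj₂ p)) ,
                          λ η ub → ≤-trans (σ-above δ δ<γ) (σ-least η λ ξ p → ub ξ (p , C<δ p))) ,
                         ζ , ζ<δ
        in none (δ , proj₂ (C-closed γ<κ) δ δ<γ limitPoint , ≤-refl)

    Step : Ord → Ord → Ord → Set ℓ
    Step δ γ ξ = ξ ∈ C γ × δ ≤ ξ

    -- min (C γ ∖ δ)
    step : Ord → Ord → Ord
    step δ γ = choose (Least (Step δ γ)) δ

    opaque
      step-least : ∀ {ζ δ γ} → ζ < δ → δ < γ → γ < κ → Least (Step δ γ) (step δ γ)
      step-least {δ = δ} {γ} ζ<δ δ<γ γ<κ =
        choose-∈ (Least (Step δ γ)) (least (member-≥ ζ<δ δ<γ γ<κ))

    -- Last P δ β γ : the walk from β down to δ stays inside P until it reaches γ, and the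
    -- next step leaves P.
    data Last (P : SetOfOrd) (δ : Ord) : Ord → Ord → Set ℓ where
      stop : ∀ {β} → ¬ P (step δ β) → Last P δ β β
      next : ∀ {β γ} → P (step δ β) → Last P δ (step δ β) γ → Last P δ β γ

    last-end : ∀ {P δ β γ} → Last P δ β γ → ¬ P (step δ γ)
    last-end (stop ¬p) = ¬p
    last-end (next _ l) = last-end l

    last-∈ : ∀ {P δ β γ} → Last P δ β γ → P β → P γ
    last-∈ (stop _) q = q
    last-∈ (next p l) _ = last-∈ l p

    last-unique : ∀ {P δ β γ γ′} → Last P δ β γ → Last P δ β γ′ → γ ≡ γ′
    last-unique (stop _) (stop _) = refl
    last-unique (stop ¬p) (next p _) = ⊥-elim (¬p p)
    last-unique (next p _) (stop ¬p) = ⊥-elim (¬p p)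
    last-unique (next _ l) (next _ l′) = last-unique l l′

    last-weaken : ∀ {P Q δ β γ} → P ⊆ Q → Last P δ β γ → ¬ Q (step δ γ) → Last Q δ β γ
    last-weaken P⊆Q (stop _) ¬q = stop ¬q
    last-weaken P⊆Q (next p l) ¬q = next (P⊆Q p) (last-weaken P⊆Q l ¬q)

    -- Walks descend because `C β ⊆ ↓ β`, and points of `P` lie above `δ`, where the next step is
    -- again defined.
    last-exists : ∀ {P ζ δ} → ζ < δ → (∀ {ξ} → P ξ → δ < ξ) →
                  ∀ β → δ < β → β < κ → ∃[ γ ] γ ≤ β × Last P δ β γ
    last-exists {P} {δ = δ} ζ<δ P> = All.wfRec wellFounded _
      (λ β → δ < β → β < κ → ∃[ γ ] γ ≤ β × Last P δ β γ) go
      where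
      go : ∀ β → WfRec _<_ (λ β → δ < β → β < κ → ∃[ γ ] γ ≤ β × Last P δ β γ) β →
           δ < β → β < κ → ∃[ γ ] γ ≤ β × Last P δ β γ
      go β ih δ<β β<κ with em {P = P (step δ β)}
      ... | no ¬p = β , ≤-refl , stop ¬p
      ... | yes p with proj₁ (C-closed β<κ) (proj₁ (proj₁ (step-least ζ<δ δ<β β<κ)))
      ... | s<β with ih s<β (P> p) (<-trans s<β β<κ)
      ... | γ , γ≤s , l = γ , inj₁ (≤-<-trans γ≤s s<β) , next p l

    isolated : ∀ {A : SetOfOrd} {ζ ν} → ζ < ν → ¬ IsLimitPoint A ν →
               ∃[ η ] η < ν × (∀ {ξ} → ξ ∈ A → ξ < ν → ξ ≤ η)
    isolated {ζ = ζ} ζ<ν ¬lim =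
      let η , ub , ν≰η = ¬∀∈⇒∃ λ sup → ¬lim (((λ _ p → inj₁ (proj₂ p)) , sup) , ζ , ζ<ν)
      in η , ≰⇒> ν≰η , λ p ξ<ν → ub _ (p , ξ<ν)

    -- A walk to ν passes only through γ with C γ ∩ ν bounded below ν before its last step, so
    -- walks to smaller ordinals close to ν begin in the same way.
    last-lower : ∀ {ζ ν β γ} → ζ < ν → ν < β → β < κ → Last (ν <_) ν β γ →
                 ∃[ η ] η < ν × (∀ {δ} → η < δ → δ < ν → Last (ν <_) δ β γ)
    last-lower {ζ} {ν} {β} ζ<ν ν<β β<κ (stop ¬ν<) = ζ , ζ<ν , λ ζ<δ δ<ν → stop λ ν<s →
      let (s∈ , ν≤s) , _ = step-least ζ<ν ν<β β<κ
      in ¬ν< (<-≤-trans ν<s (Least⇒≤ (step-least ζ<δ (<-trans δ<ν ν<β) β<κ)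
                                   (s∈ , ≤-trans (inj₁ δ<ν) ν≤s)))
    last-lower {ζ} {ν} {β} {γ} ζ<ν ν<β β<κ (next ν<s l) =
      let s-least@((s∈ , ν≤s) , _) = step-least ζ<ν ν<β β<κ
          -- The least element of `C β` at or above `ν` exceeds `ν`, so `ν` is not in `C β` and by
          -- closedness not a limit point of it. For `δ` between `η` and `ν` the steps toward `δ`
          -- and `ν` thus coincide.
          η , η<ν , iso = isolated ζ<ν λ lim → ≤⇒≯
            (Least⇒≤ s-least (proj₂ (C-closed β<κ) ν ν<β lim , ≤-refl)) ν<s
          η′ , η′<ν , low = last-lower ζ<ν ν<s (<-trans (proj₁ (C-closed β<κ) s∈) β<κ) l
          η″ , η≤ , η′≤ , lub = upper η η′
      in η″ , lub η<ν η′<ν , λ {δ} η″<δ δ<ν →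
        let η<δ = ≤-<-trans η≤ η″<δ
            t-least@((t∈ , δ≤t) , _) = step-least η<δ (<-trans δ<ν ν<β) β<κ
            t≡s : step ν β ≡ step δ β
            t≡s = ≤-antisym
              (Least⇒≤ s-least (t∈ , ≮⇒≥ λ t<ν → ≤⇒≯ (≤-trans δ≤t (iso t∈ t<ν)) η<δ))
              (Least⇒≤ t-least (s∈ , ≤-trans (inj₁ δ<ν) ν≤s))
        in next (subst (ν <_) t≡s ν<s)
                (subst (λ x → Last (ν <_) δ x γ) t≡s (low (≤-<-trans η′≤ η″<δ) δ<ν))

    Hits : Ord → Ord → Set ℓ
    Hits δ ν = ∀* (λ β → ∃[ γ ] Last (ν <_) δ β γ × ν ∈ C γ)

    opaque
      -- A walk from `β > ε` to `ε` ends by stepping onto `ε`, and by `last-lower` this part of it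
      -- is shared by walks to all `δ` in an interval `(η, ε)`. Continuity makes `η` independent of
      -- `β`.
      hits-below : ∀ {F α} (p : ClosurePoint F α) → let open ClosurePoint p in
                   ∃[ η ] η < ε × (∀ {δ} → η < δ → δ < ε → Hits δ ε)
      hits-below {α = α} p
        with ClosurePoint.continuous p R (∀*-map (λ {β} → start {β}) (∀*-> ε<κ))
        where
        open ClosurePoint p
        R : Ord → Ord → Set ℓ
        R β η = ∀ {δ} → η < δ → δ < ε → ∃[ γ ] Last (ε <_) δ β γ × ε ∈ C γ
        start : ∀ {β} → β < κ → ε < β → ∃[ η ] η < ε × R β η
        start {β} β<κ ε<β with last-exists α<ε id β ε<β β<κ
        ... | γ , γ≤β , l with step-least α<ε (last-∈ l ε<β) (≤-<-trans γ≤β β<κ)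
        ... | (s∈ , ε≤s) , _ with last-lower α<ε ε<β β<κ l
        ... | η , η<ε , low = η , η<ε , λ η<δ δ<ε →
          γ , low η<δ δ<ε , subst (_∈ C γ) (≤-antisym (≮⇒≥ (last-end l)) ε≤s) s∈
      ... | η , η<ε , ∀*R = η , η<ε , λ η<δ δ<ε → ∀*-map
        (λ _ (η′ , η′≤ , r) → r (≤-<-trans η′≤ η<δ) δ<ε) ∀*R

    Target : Ord → Ord → Set ℓ
    Target ζ δ = ζ < δ × δ < κ × (∀ α → α < κ → ∃[ ν ] α ≤ ν × ν < κ × Hits δ ν)

    opaque
      -- Otherwise let `F δ` bound the `ν` hit by walks to `δ`. At a closure point `ε` of `F`, walks
      -- to some `δ < ε` hit `ε`, although `F δ < ε`.
      target : ∃[ ζ ] ∃[ δ ] Target ζ δ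
      target with κ.inhabited
      ... | zero , zero<κ = dne λ none → refute none (closurePoint F F<κ zero<κ)
        where
        Missed : Ord → Ord → Set ℓ
        Missed δ α = α < κ × (∀ ν → α ≤ ν → ν < κ → ¬ Hits δ ν)
        F : Ord → Ord
        F δ = choose (Missed δ) zero
        F<κ : ∀ {δ} → δ < κ → F δ < κ
        F<κ {δ} _ = choose-elim {P = Missed δ} {Q = _< κ} proj₁ zero<κ
        F-missed : ¬ (∃[ ζ ] ∃[ δ ] Target ζ δ) → ∀ {ζ δ} → ζ < δ → δ < κ → Missed δ (F δ)
        F-missed none {ζ} {δ} ζ<δ δ<κ with ¬∀∈⇒∃ (λ all → none (ζ , δ , ζ<δ , δ<κ , all))
        ... | α , α<κ , missed =
          choose-∈ (Missed δ) (α , α<κ , λ ν α≤ν ν<κ hits → missed (ν , α≤ν , ν<κ , hits))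
        refute : ∀ {α} → ¬ (∃[ ζ ] ∃[ δ ] Target ζ δ) → ¬ ClosurePoint F α
        refute none p with hits-below p
        ... | η , η<ε , hits with ClosurePoint.limit p η<ε
        ... | δ , η<δ , δ<ε =
          proj₂ (F-missed none η<δ (<-trans δ<ε ε<κ)) ε (inj₁ (closed δ<ε)) ε<κ (hits η<δ δ<ε)
          where open ClosurePoint p

    Agree : Ord → Ord → Ord → Set ℓ
    Agree δ ν ν′ = ∀* (λ β → ∃[ γ ] Last (ν <_) δ β γ × Last (ν′ <_) δ β γ)

    opaque
      -- Let `γ` be the last point at or above `ε` on the walk from `β` to `δ`. The next point is
      -- some `η < ε`, so `γ` is also the last point above each `ν` in `[η, ε)`. Continuity makes
      -- `η` uniform.
      agree-below : ∀ {F ζ δ} → ζ < δ → (p : ClosurePoint F δ) → let open ClosurePoint p in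
                    ∃[ η ] η < ε × (∀ {ν ν′} → η ≤ ν → ν < ε → η ≤ ν′ → ν′ < ε → Agree δ ν ν′)
      agree-below {δ = δ} ζ<δ p
        with ClosurePoint.continuous p R (∀*-map (λ {β} → start {β}) (∀*-> ε<κ))
        where
        open ClosurePoint p
        R : Ord → Ord → Set ℓ
        R β η = ∃[ γ ] (∀ {ν} → η ≤ ν → ν < ε → Last (ν <_) δ β γ)
        start : ∀ {β} → β < κ → ε < β → ∃[ η ] η < ε × R β η
        start {β} β<κ ε<β with last-exists {P = ε ≤_} ζ<δ (<-≤-trans α<ε) β (<-trans α<ε ε<β) β<κ
        ... | γ , _ , l = step δ γ , ≰⇒> (last-end l) , γ , λ η≤ν ν<ε →
          last-weaken (<-≤-trans ν<ε) l (≤⇒≯ η≤ν)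
      ... | η , η<ε , ∀*R = η , η<ε , λ η≤ν ν<ε η≤ν′ ν′<ε → ∀*-map
        (λ _ (_ , η′≤ , γ , l) → γ , l (≤-trans η′≤ η≤ν) ν<ε , l (≤-trans η′≤ η≤ν′) ν′<ε) ∀*R

    Stable : Ord → Ord → Set ℓ
    Stable δ ν = δ ≤ ν × ν < κ × (∀ ν′ → ν ≤ ν′ → ν′ < κ → Agree δ ν ν′)

    opaque
      -- Otherwise `F` moves each `ν ≥ δ` to a later ordinal disagreeing with it; below a closure
      -- point of `F` this contradicts `agree-below`.
      stable : ∀ {ζ δ} → ζ < δ → δ < κ → ∃[ ν ] Stable δ ν
      stable {δ = δ} ζ<δ δ<κ = dne λ none → refute none (closurePoint F F<κ δ<κ)
        where
        Change : Ord → Ord → Set ℓ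
        Change ν ν′ = ν ≤ ν′ × ν′ < κ × ¬ Agree δ ν ν′
        F : Ord → Ord
        F ν = choose (Change ν) δ
        F<κ : ∀ {ν} → ν < κ → F ν < κ
        F<κ {ν} _ = choose-elim {P = Change ν} {Q = _< κ} (proj₁ ∘ proj₂) δ<κ
        F-change : ¬ (∃[ ν ] Stable δ ν) → ∀ {ν} → δ ≤ ν → ν < κ → Change ν (F ν)
        F-change none {ν} δ≤ν ν<κ with ¬∀∈⇒∃ (λ all → none (ν , δ≤ν , ν<κ , all))
        ... | ν′ , ν≤ν′ , rest with ¬∀⇒∃ rest
        ... | ν′<κ , ¬agree = choose-∈ (Change ν) (ν′ , ν≤ν′ , ν′<κ , ¬agree)
        refute : ¬ (∃[ ν ] Stable δ ν) → ¬ ClosurePoint F δ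
        refute none p with agree-below ζ<δ p
        ... | η , η<ε , agree with upper η δ
        ... | ν , η≤ν , δ≤ν , lub
          with F-change none δ≤ν (<-trans (lub η<ε (ClosurePoint.α<ε p)) (ClosurePoint.ε<κ p))
        ... | ν≤F , _ , ¬agree = ¬agree (agree η≤ν ν<ε (≤-trans η≤ν ν≤F) (closed ν<ε))
          where
          open ClosurePoint p
          ν<ε : ν < ε
          ν<ε = lub η<ε α<ε

    opaque
      -- `h β` is the last point above `ν₀` on the walk from `β` to `δ`. By stability it is almost
      -- always the point from which the walk steps over a given hit `ν ≥ ν₀`.
      reindex-∈ : Σ[ h ∈ (Ord → Ord) ] (∀ {β} → β < κ → h β < κ) ×
                  (∀ α → α < κ → ∃[ ν ] α ≤ ν × ν < κ × ∀* (λ β → ν ∈ C (h β)))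
      reindex-∈ with target
      ... | ζ , δ , ζ<δ , δ<κ , hit with stable ζ<δ δ<κ
      ... | ν₀ , δ≤ν₀ , ν₀<κ , agree = h , (λ β<κ → ≤-<-trans h≤ β<κ) , often
        where
        Value : Ord → Ord → Set ℓ
        Value β γ = γ ≤ β × Last (ν₀ <_) δ β γ
        h : Ord → Ord
        h β = choose (Value β) β
        h≤ : ∀ {β} → h β ≤ β
        h≤ {β} = choose-elim {P = Value β} {Q = _≤ β} proj₁ ≤-refl
        often : ∀ α → α < κ → ∃[ ν ] α ≤ ν × ν < κ × ∀* (λ β → ν ∈ C (h β))
        often α α<κ with upper α ν₀
        ... | α′ , α≤ , ν₀≤ , lub with hit α′ (lub α<κ ν₀<κ)
        ... | ν , α′≤ν , ν<κ , hits = ν , ≤-trans α≤ α′≤ν , ν<κ , ∀*-map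
              (λ { {β} β<κ (((γ , l , ν∈) , (γ′ , l₀ , l′)) , ν₀<β) →
                 let v = last-exists {P = ν₀ <_} ζ<δ (≤-<-trans δ≤ν₀) β (≤-<-trans δ≤ν₀ ν₀<β) β<κ
                     h≡γ′ = last-unique (proj₂ (choose-∈ (Value β) {β} v)) l₀
                 in subst (λ x → ν ∈ C x) (trans (last-unique l l′) (sym h≡γ′)) ν∈ })
              (∀*-zip (λ _ x y → x , y)
                (∀*-zip (λ _ x y → x , y) hits (agree ν (≤-trans ν₀≤ α′≤ν) ν<κ)) (∀*-> ν₀<κ))

    opaque
      reindex-acc : Σ[ h ∈ (Ord → Ord) ] (∀ {β} → β < κ → h β < κ) ×
                    (∀ α → α < κ → ∃[ ε ] α ≤ ε × ε < κ × ∀* (λ β → ε ∈ acc (C (h β))))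
      reindex-acc with reindex-∈
      ... | h , h<κ , often = h , h<κ , λ α α<κ → accumulate (closurePoint F F<κ α<κ)
        where
        Hit : Ord → Ord → Set ℓ
        Hit α ν = α ≤ ν × ν < κ × ∀* (λ β → ν ∈ C (h β))
        F : Ord → Ord
        F α = choose (Hit α) α
        F-hit : ∀ {α} → α < κ → Hit α (F α)
        F-hit {α} α<κ = choose-∈ (Hit α) (often α α<κ)
        F<κ : ∀ {α} → α < κ → F α < κ
        F<κ α<κ = proj₁ (proj₂ (F-hit α<κ))
        accumulate : ∀ {α} → ClosurePoint F α → ∃[ ε ] α ≤ ε × ε < κ × ∀* (λ β → ε ∈ acc (C (h β)))
        -- A further hit `ν ≥ ε` in `C (h β)` shows `ε < h β`, where closedness of `C (h β)`
        -- applies.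
        accumulate p with often (ClosurePoint.ε p) (ClosurePoint.ε<κ p)
        ... | ν , ε≤ν , _ , ν∈ = ε , inj₁ α<ε , ε<κ , ∀*-zip
                (λ β<κ lim ν∈C → let hβ<κ = h<κ β<κ in
                   proj₂ (C-closed hβ<κ) ε (≤-<-trans ε≤ν (proj₁ (C-closed hβ<κ) ν∈C)) lim , lim)
                limits ν∈
          where
          open ClosurePoint p
          limits : ∀* (λ β → IsLimitPoint (C (h β)) ε)
          -- Otherwise one `η < ε` bounds almost all `C (h β) ∩ ε`, yet for `η < α < ε` the ordinal
          -- `F α < ε` lies in almost all of them.
          limits = dne λ ¬lim →
            let η , η<ε , bounded = continuous (λ β η → ∀ {ξ} → ξ ∈ C (h β) → ξ < ε → ξ ≤ η)
                  (∀*-map (λ _ → isolated α<ε) (¬∀*⇒∀*¬ ¬lim))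
                α , η<α , α<ε′ = limit η<ε
                α≤F , _ , F∈ = F-hit (<-trans α<ε′ ε<κ)
                _ , _ , absurd = ∀*⇒∃ (∀*-zip (λ _ (η′ , η′≤ , b) F∈C →
                  ≤-trans (b F∈C (closed α<ε′)) η′≤) bounded F∈)
            in ≤⇒≯ absurd (<-≤-trans η<α α≤F)

  -- Bounding χ by small covers.

  module _ {C : Ord → SetOfOrd} where

    -- The predicate minimised in `IsChi κ C`, in a form to which `least` applies.
    BoundedBy : Ord → Set (Level.suc ℓ)
    BoundedBy χ = IsCardinal χ × χ ≤ κ ×
      (Σ[ Δ ∈ SetOfOrd ] Σ[ b ∈ (Ord → SetOfOrd) ]
        (Δ ∈[ κ ]^ κ) ×
        (∀ α → α < κ → b α ∈[ κ ]^ χ) ×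
        (∀ α → α < κ → ∀ δ → δ ∈ (Δ ∩ ↓ α) → ∃[ β ] β ∈ b α × δ ∈ C β))

    module _ (Δ : SetOfOrd) {μ : Ord} (μ<θ : μ < θ)
      (cover : ∀ α → α < κ → Σ[ v ∈ (Ord → Ord) ] (∀ {i} → i < μ → v i < κ) ×
               (∀ δ → δ ∈ Δ → δ < α → ∃[ i ] i < μ × δ ∈ C (v i))) where

      Cover : Ord → Ord → Set (Level.suc ℓ)
      Cover χ α = Σ[ b ∈ SetOfOrd ] (b ⊆ ↓ κ) × (b ≅ (↓ χ)) ×
                  (∀ δ → δ ∈ (Δ ∩ ↓ α) → ∃[ β ] β ∈ b × δ ∈ C β)

      opaque
        -- The `v i` may repeat, so the exact size of the covering set can vary with `α`.
        some-size : ∀ α → α < κ → ∃[ χ ] IsCardinal χ × χ ≤ μ × Cover χ α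
        some-size α α<κ with cover α α<κ
        ... | v , v<κ , covers with cardinality (λ β → ∃[ i ] i < μ × v i ≡ β) v id
        ... | χ , χ-card , χ≤μ , e = χ , χ-card , χ≤μ , _ , (λ { (_ , i<μ , refl) → v<κ i<μ }) , e ,
                λ δ (δ∈ , δ<α) → let i , i<μ , δ∈C = covers δ δ∈ δ<α in v i , (i , i<μ , refl) , δ∈C

      Uniform : Ord → Set (Level.suc ℓ)
      Uniform χ = IsCardinal χ × χ ≤ μ × (∀ α → α < κ → Cover χ α)

      opaque
        -- The sizes of the covering sets lie below θ < cf κ, so one size occurs for
        -- unboundedly many α, and a cover for α also serves all smaller ordinals.
        uniform-size : ∃[ χ ] Uniform χ
        uniform-size = dne refute
          where
          Fails : Ord → Ord → Set (Level.suc ℓ)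
          Fails χ α = α < κ × ¬ Cover χ α
          f : Ord → Ord
          f χ = choose (Fails χ) (proj₁ κ.inhabited)
          f<κ : ∀ {χ} → f χ < κ
          f<κ {χ} = choose-elim {P = Fails χ} {Q = _< κ} proj₁ (proj₂ κ.inhabited)
          refute : ¬ ¬ (∃[ χ ] Uniform χ)
          refute none with κ.bound f θ<κ (λ _ → f<κ)
          ... | ζ , ζ<κ , f<ζ with some-size ζ ζ<κ
          ... | χ , χ-card , χ≤μ , b , b⊆ , e , covers
            with ¬∀∈⇒∃ (λ all → none (χ , χ-card , χ≤μ , all))
          ... | α , fails = proj₂ (choose-∈ (Fails χ) (α , fails))
            (b , b⊆ , e , λ δ (δ∈ , δ<) → covers δ (δ∈ , <-trans δ< (f<ζ (≤-<-trans χ≤μ μ<θ))))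

      opaque
        χ-≤ : Δ ⊆ (↓ κ) → Unbounded Δ κ → ∃[ χ ] IsChi κ C χ × χ ≤ μ
        χ-≤ Δ⊆ Δ-unbounded with uniform-size
        ... | χ , χ-card , χ≤μ , covers = finish (least {P = BoundedBy} (χ , bounded))
          where
          b : Ord → SetOfOrd
          b α with em {P = α < κ}
          ... | yes α<κ = proj₁ (covers α α<κ)
          -- The empty set, as a junk value outside `κ`.
          ... | no _ = λ _ → α < α
          b-cover : ∀ α → α < κ → (b α ⊆ ↓ κ) × (b α ≅ (↓ χ)) ×
                    (∀ δ → δ ∈ (Δ ∩ ↓ α) → ∃[ β ] β ∈ b α × δ ∈ C β)
          b-cover α α<κ with em {P = α < κ}
          ... | yes α<κ′ = proj₂ (covers α α<κ′)
          ... | no α≮κ = ⊥-elim (α≮κ α<κ)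
          bounded : BoundedBy χ
          bounded = χ-card , inj₁ (≤-<-trans χ≤μ (<-trans μ<θ θ<κ)) , Δ , b ,
            (Δ⊆ , ≅⇒Bijection (κ.unbounded-≅ Δ⊆ Δ-unbounded)) ,
            (λ α α<κ → proj₁ (b-cover α α<κ) , ≅⇒Bijection (proj₁ (proj₂ (b-cover α α<κ)))) ,
            λ α α<κ → proj₂ (proj₂ (b-cover α α<κ))
          finish : ∃[ χ′ ] Least BoundedBy χ′ → ∃[ χ′ ] IsChi κ C χ′ × χ′ ≤ μ
          finish (χ′ , lst) = χ′ , lst , ≤-trans (Least⇒≤ lst bounded) χ≤μ

  -- Families with few values almost everywhere.

  -- `T` takes at most `ν` values on `Y`, up to extensional equality: `same` can be applied both
  -- ways round.
  record Classified (T : Ord → SetOfOrd) : Set (Level.suc ℓ) where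
    field
      ν    : Ord
      ν<θ  : ν < θ
      g    : Ord → Ord
      Y    : SetOfOrd
      ∀*Y  : ∀* Y
      g<ν  : ∀ {β} → β ∈ Y → g β < ν
      same : ∀ {β β′} → β ∈ Y → β′ ∈ Y → g β ≡ g β′ → T β ⊆ T β′

  Coverable : Ord → (Ord → SetOfOrd) → Set ℓ
  Coverable μ T = Σ[ t ∈ (Ord → Ord) ] (∀ {i} → i < μ → t i < κ) ×
                  ∀* (λ β → ∃[ i ] i < μ × T β ⊆ T (t i))

  opaque
    -- The product of the θ many classifications takes at most 2^θ < κ values, hence fewer than
    -- θ values on a set in 𝒰; their number μ works for the μ-th family.
    simultaneous : (2^ θ) ≺ᶜ ⟦ ↓ κ ⟧ → (T : Ord → Ord → SetOfOrd) → (∀ μ → Classified (T μ)) →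
                   ∃[ μ ] IsCardinal μ × μ < θ × Coverable μ (T μ)
    simultaneous (ι , small) T classes =
        finish (θ.disjoint-segments ν λ {μ} _ → Classified.ν<θ (classes μ)) (κ.small⇒bounded ι small)
      where
      open module Class μ = Classified (classes μ) hiding (same)
      finish : Σ[ e ∈ (Ord → Ord → Ord) ]
          (∀ {μ ξ} → μ < θ → ξ < ν μ → e μ ξ < θ) ×
          (∀ {μ μ′ ξ ξ′} → μ < θ → μ′ < θ → ξ < ν μ → ξ′ < ν μ′ →
             e μ ξ ≡ e μ′ ξ′ → μ ≡ μ′ × ξ ≡ ξ′) →
        ∃[ ζ ] ζ < κ × (∀ x → proj₁ (Injection.to ι x) < ζ) →
        ∃[ μ ] IsCardinal μ × μ < θ × Coverable μ (T μ)
      finish (e , e<θ , e-injective) (ζ , ζ<κ , ι<ζ) =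
          count (few-values F ζ<κ (∀*-all λ {β} _ → ι<ζ (characteristic θ (Code β))))
        where
        -- The graph of `μ ↦ g μ β` as a subset of `θ`. Values out of range are dropped, since `β`
        -- need not lie in all the `Y μ` at once.
        Code : Ord → SetOfOrd
        Code β γ = ∃[ μ ] μ < θ × g μ β < ν μ × e μ (g μ β) ≡ γ
        F : Ord → Ord
        F β = proj₁ (Injection.to ι (characteristic θ (Code β)))
        decode : ∀ {β β′ μ} → μ < θ → g μ β < ν μ → F β ≡ F β′ → g μ β ≡ g μ β′
        decode {β} {β′} {μ} μ<θ g<ν′ eq
          with does-≡⇒ (Injection.injective ι
                          {characteristic θ (Code β)} {characteristic θ (Code β′)} eq
                          (e μ (g μ β) , e<θ μ<θ g<ν′)) (μ , μ<θ , g<ν′ , refl)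
        ... | μ′ , μ′<θ , g<ν″ , eq′ with e-injective μ<θ μ′<θ g<ν′ g<ν″ (sym eq′)
        ... | refl , g≡g = g≡g
        count : ∃[ δ ] IsCardinal δ × δ < θ × FewValues F δ →
                ∃[ μ ] IsCardinal μ × μ < θ × Coverable μ (T μ)
        count (μ , μ-card , μ<θ , H , c , F∈H) = μ , μ-card , μ<θ , t , t<κ ,
          ∀*-zip (λ {β} → covered {β}) (∀*Y μ) F∈H
          where
          Rep : Ord → Ord → Set ℓ
          Rep i β = β < κ × β ∈ Y μ × F β ∈ H × to c (F β) ≡ i
          t : Ord → Ord
          t i = choose (Rep i) (proj₁ κ.inhabited)
          t<κ : ∀ {i} → i < μ → t i < κ
          t<κ {i} _ = choose-elim {P = Rep i} {Q = _< κ} proj₁ (proj₂ κ.inhabited)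
          covered : ∀ {β} → β < κ → β ∈ Y μ → F β ∈ H → ∃[ i ] i < μ × T μ β ⊆ T μ (t i)
          covered {β} β<κ β∈Y Fβ∈H
            with choose-∈ (Rep (to c (F β))) {proj₁ κ.inhabited} (β , β<κ , β∈Y , Fβ∈H , refl)
          ... | _ , β′∈Y , Fβ′∈H , eq = to c (F β) , to-∈ c Fβ∈H ,
            Classified.same (classes μ) β∈Y β′∈Y (decode μ<θ (g<ν μ β∈Y)
              (trans (sym (from-to c Fβ∈H)) (trans (cong (from c) (sym eq)) (from-to c Fβ′∈H))))

    -- The constantly empty family fills the places of those `μ` that are not cardinals below `θ`.
    trivial-class : Classified (λ _ _ → θ < θ)
    trivial-class with θ.inhabited
    ... | zero , zero<θ with θ.limit zero<θ
    ... | one , zero<one , one<θ = record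
      { ν = one ; ν<θ = one<θ ; g = λ _ → zero ; Y = ↓ κ ; ∀*Y = ∀*-all id
      ; g<ν = λ _ → zero<one ; same = λ _ _ _ p → p }

  -- Transversals of square sequences.

  module SquareSequence {𝒞 : Ord → Family} (sq : IsSquareSequence κ 𝒞)
                        {C : Ord → SetOfOrd} (C∈𝒞 : ∀ α → α < κ → C α ∈ 𝒞 α) where

    open IsSquareSequence sq using (small; closed; sup-C≡sup-α; coherent)

    opaque
      -- Coherence puts `C (h β) ∩ ↓ ε` into `𝒞 ε`, whose smallness lets its members be numbered by
      -- ordinals below some `ζ < κ`; `few-values` applies to these numbers.
      classify : ∀ {h : Ord → Ord} {ε} → (∀ {β} → β < κ → h β < κ) → ε < κ →
                 ∀* (λ β → ε ∈ acc (C (h β))) →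
                 Classified (λ β → C (h β) ∩ ↓ ε)
      classify {h} {ε} h<κ ε<κ acc∈ with small ε ε<κ
      ... | ι , smaller with κ.small⇒bounded ι smaller
      ... | ζ , ζ<κ , ι<ζ =
        finish (few-values f ζ<κ (∀*-map (λ {β} β<κ p → proj₂ (f-spec {β} β<κ p)) acc∈))
        where
        Val : Ord → Ord → Set ℓ
        Val β ξ = Σ[ m ∈ (C (h β) ∩ ↓ ε) ∈ 𝒞 ε ] proj₁ (Injection.to ι (_ , m)) ≡ ξ
        f : Ord → Ord
        f β = choose (Val β) ε
        f-spec : ∀ {β} → β < κ → ε ∈ acc (C (h β)) → Val β (f β) × f β < ζ
        f-spec {β} β<κ p = v , subst (_< ζ) (proj₂ v) (ι<ζ _)
          where
          m : (C (h β) ∩ ↓ ε) ∈ 𝒞 ε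
          m = coherent (h β) (h<κ β<κ) (C (h β)) (C∈𝒞 (h β) (h<κ β<κ)) ε p
          v : Val β (f β)
          v = choose-∈ (Val β) (_ , m , refl)
        finish : ∃[ δ ] IsCardinal δ × δ < θ × FewValues f δ → Classified (λ β → C (h β) ∩ ↓ ε)
        finish (δ , _ , δ<θ , H , e , f∈H) = record
          { ν = δ ; ν<θ = δ<θ ; g = to e ∘ f ; Y = λ β → Val β (f β) × f β ∈ H
          ; ∀*Y = ∀*-zip (λ {β} β<κ p q → proj₁ (f-spec {β} β<κ p) , q) acc∈ f∈H
          ; g<ν = to-∈ e ∘ proj₂
          ; same = λ ((m , eq) , q) ((m′ , eq′) , q′) g≡ →
              let f≡ = trans (sym (from-to e q)) (trans (cong (from e) g≡) (from-to e q′))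
              in proj₁ (Injection.injective ι {_ , m} {_ , m′} (trans eq (trans f≡ (sym eq′)))) }

    module Walk = Walks C (λ γ<κ → closed _ γ<κ _ (C∈𝒞 _ γ<κ))
                          (λ γ<κ → sup-C≡sup-α _ γ<κ _ (C∈𝒞 _ γ<κ))

    opaque
      -- If all the families `C (h β) ∩ ↓ ε` were coverable, the `μ` sets `C (h (t i))` obtained
      -- from an `ε ≥ α` in `Δ` would cover `Δ ∩ ↓ α`, and `χ-≤` would apply.
      uncoverable-class : ∀ {μ} → μ < θ → ¬ (∃[ χ ] IsChi κ C χ × χ ≤ μ) →
                          Σ[ T ∈ (Ord → SetOfOrd) ] Classified T × ¬ Coverable μ T
      uncoverable-class {μ} μ<θ large with Walk.reindex-acc
      ... | h , h<κ , often = dne λ none → large (χ-≤ Δ μ<θ (cover none) proj₁ λ α α<κ →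
              let ε , α≤ε , ε<κ , p = often α α<κ in ε , (ε<κ , p) , α≤ε)
        where
        Δ : SetOfOrd
        Δ ε = ε < κ × ∀* (λ β → ε ∈ acc (C (h β)))
        cover : ¬ (Σ[ T ∈ (Ord → SetOfOrd) ] Classified T × ¬ Coverable μ T) →
                ∀ α → α < κ → Σ[ v ∈ (Ord → Ord) ] (∀ {i} → i < μ → v i < κ) ×
                (∀ δ → δ ∈ Δ → δ < α → ∃[ i ] i < μ × δ ∈ C (v i))
        cover none α α<κ with often α α<κ
        ... | ε , α≤ε , ε<κ , acc∈
          with dne {P = Coverable μ (λ β → C (h β) ∩ ↓ ε)}
                   (λ ¬c → none (_ , classify h<κ ε<κ acc∈ , ¬c))
        ... | t , t<κ , covers = h ∘ t , h<κ ∘ t<κ , λ δ (_ , δ∈) δ<α →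
          -- Some `β` has both `δ ∈ C (h β)` and `C (h β) ∩ ↓ ε` inside one of the covering sets.
          let _ , _ , i , i<μ , δ∈C = ∀*⇒∃ (∀*-zip
                {R = λ _ → ∃[ i ] i < μ × δ ∈ C (h (t i))}
                (λ _ p (i , i<μ , ⊆) → i , i<μ , proj₁ (⊆ (proj₁ p , <-≤-trans δ<α α≤ε))) δ∈ covers)
          in i , i<μ , δ∈C

  -- One bound for all transversals.

  Bounds : Ord → Pred (Ord → SetOfOrd) (Level.suc ℓ)
  Bounds μ C = ∃[ χ ] IsChi κ C χ × χ ≤ μ

  Uncoverable : Ord → Set (Level.suc ℓ)
  Uncoverable μ = Σ[ T ∈ (Ord → SetOfOrd) ] Classified T × ¬ Coverable μ T

  opaque
    unbounded-transversal : ∀ {μ} → μ < θ → ∃[ C ] IsTransversal κ C × ¬ Bounds μ C → Uncoverable μ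
    unbounded-transversal μ<θ (C , (𝒞 , sq , C∈𝒞) , large) =
      SquareSequence.uncoverable-class sq C∈𝒞 μ<θ large

  opaque
    common-bound : (2^ θ) ≺ᶜ ⟦ ↓ κ ⟧ →
                   ∃[ μ ] IsCardinal μ × μ < θ × (∀ C → IsTransversal κ C → Bounds μ C)
    common-bound 2^θ<κ = dne λ none → refute λ μ card μ<θ → unbounded-transversal μ<θ
        (¬∀∈⇒∃ {P = IsTransversal κ} {Q = Bounds μ} λ all → none (μ , card , μ<θ , all))
      where
      refute : ¬ (∀ μ → IsCardinal μ → μ < θ → Uncoverable μ)
      refute uncoverable = clash (simultaneous 2^θ<κ (proj₁ ∘ family) (proj₁ ∘ proj₂ ∘ family))
        where
        family : ∀ μ → Σ[ T ∈ (Ord → SetOfOrd) ] Classified T ×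
                       (IsCardinal μ → μ < θ → ¬ Coverable μ T)
        family μ with em {P = IsCardinal μ × μ < θ}
        ... | no ¬p = _ , trivial-class , λ card μ<θ → ⊥-elim (¬p (card , μ<θ))
        ... | yes (card , μ<θ) =
            let T , class , ¬c = uncoverable μ card μ<θ in T , class , λ _ _ → ¬c
        clash : ¬ (∃[ μ ] IsCardinal μ × μ < θ × Coverable μ (proj₁ (family μ)))
        clash (μ , card , μ<θ , c) = proj₂ (proj₂ (family μ)) card μ<θ c

theorem4p5 :
    (∀ {a} → ExcludedMiddle a) →
    (∀ {a b} → Extensionality a b) →
    ∀ {ℓ} (𝕆 : WellOrder ℓ) → let open Ordinals 𝕆 in
    ∀ (θ κ : Ord) →
    IsInfiniteRegular θ →
    IsInfiniteRegular κ →
    (2^ θ) ≺ᶜ ⟦ ↓ κ ⟧ →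
    (∃[ 𝒰 ] IsUltrafilter κ 𝒰 × IsUniform κ 𝒰 ×
      (∀ μ → IsCardinal μ → θ ≤ μ → μ < κ → IsIndecomposable κ 𝒰 μ)) →
    ∃[ μ ] IsCardinal μ × μ < θ ×
      (∀ C → IsTransversal κ C → ∃[ χ ] IsChi κ C χ × χ ≤ μ)
theorem4p5 em ext 𝕆 θ κ θ-regular κ-regular 2^θ<κ (_ , 𝒰-ultrafilter , 𝒰-uniform , indecomposable) =
  Ultrafilters.common-bound em ext 𝕆 θ-regular κ-regular (WellOrdered.<-2^ em ext 𝕆 2^θ<κ)
    𝒰-ultrafilter 𝒰-uniform indecomposable 2^θ<κ
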